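{- There exist constants $c>0$ and $\varepsilon_0>0$ such that for every $\varepsilon\in(0,\varepsilon_0)$ we have $D(\varepsilon)\ge \mathsf{tow}(c\,\varepsilon^{ -1/3})$. (In the paper's notation: $D(\varepsilon)\ge \mathsf{tow}(\Theta(\varepsilon^{ -1/3}))$.)
   Context: For a graph $G$ and disjoint nonempty vertex sets $A,B$, let $e(A,B)$ be the number of edges with one end in $A$ and the other in $B$, and $\deg(v,B)$ the number of neighbours of $v$ in $B$. A pair $(A,B)$ of disjoint nonempty vertex sets is $\varepsilon$-degular if there exist $A^-\subseteq A$, $B^-\subseteq B$ with $|A^-|\le\varepsilon|A|$, $|B^-|\le\varepsilon|B|$ such that $\left|\deg(a,B)-\frac{e(A,B)}{|A|}\right|\le\varepsilon|B|$ for every $a\in A\setminus A^-$ and $\left|\deg(b,A)-\frac{e(A,B)}{|B|}\right|\le\varepsilon|A|$ for every $b\in B\setminus B^-$. A partition $V(G)=V_1\sqcup\dots\sqcup V_\ell$ is an $\varepsilon$-degular partition of complexity $\ell$ if (i) $\big||V_i|-|V_j|\big|\le 1$ for all $i,j\in[\ell]$, and (ii) for each $i\in[\ell]$, for at least $(1-\varepsilon)\ell$ indices $j\in[\ell]\setminus\{i\}$ the pair $(V_i,V_j)$ is $\varepsilon$-degular. Define $D(\varepsilon)=\sup_G \min\{\ell : G \text{ has an } \varepsilon\text{ -degular partition of complexity } \ell\}$, the supremum over all finite graphs $G$. The tower function $\mathsf{tow}:[0,\infty)\to\mathbb{N}$ is defined by $\mathsf{tow}(x)=1$ for $x\in[0,1)$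 and $\mathsf{tow}(1+x)=2^{\mathsf{tow}(x)}$ for $x\ge 0$.
   Formalization: The parameter ε ranges over rational numbers in (0, ε₀) instead of real ones, and the constants c and ε₀ are rational. -}

module Defs where

open import Data.Bool using (Bool; true; false; _∧_; if_then_else_)
open import Data.Nat as ℕ using (ℕ; zero; suc)
open import Data.Fin using (Fin)
open import Data.List using (List; map)
open import Data.Nat.ListAction using (sum)
open import Data.List using (allFin) public
open import Data.Integer using (+_)
open import Data.Rational using (ℚ; _/_; _+_; _*_; _-_; ∣_∣; _≤_; _<_; 0ℚ; 1ℚ)
open import Data.Product using (Σ; ∃; _×_; _,_)
open import Relation.Binary.PropositionalEquality using (_≡_; _≢_)

record Graph : Set where
  field
    n     : ℕ
    adj   : Fin n → Fin n → Bool
    sym   : ∀ u v → adj u v ≡ adj v u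
    irrefl : ∀ v → adj v v ≡ false

Subset : ℕ → Set
Subset m = Fin m → Bool

sumFin : (m : ℕ) → (Fin m → ℕ) → ℕ
sumFin m f = sum (map f (allFin m))

bit : Bool → ℕ
bit true  = 1
bit false = 0

card : {m : ℕ} → Subset m → ℕ
card {m} S = sumFin m (λ x → bit (S x))

_⊆_ : {m : ℕ} → Subset m → Subset m → Set
S ⊆ T = ∀ x → S x ≡ true → T x ≡ true

ℕtoℚ : ℕ → ℚ
ℕtoℚ k = + k / 1

-- a / b as a rational; the value for b = 0 is irrelevant (only used with b ≥ 1)
divℕ : ℕ → ℕ → ℚ
divℕ a zero    = 0ℚ
divℕ a (suc b) = + a / suc b

module _ (G : Graph) where
  open Graph G

  deg : Fin n → Subset n → ℕ
  deg v B = sumFin n (λ w → bit (B w ∧ adj v w))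

  -- e(A, B): number of edges with one end in A and the other in B
  -- (for disjoint A, B this is the number of adjacent pairs (a,b) ∈ A × B)
  e : Subset n → Subset n → ℕ
  e A B = sumFin n (λ a → sumFin n (λ b → bit (A a ∧ (B b ∧ adj a b))))

  Disjoint : Subset n → Subset n → Set
  Disjoint A B = ∀ x → A x ≡ true → B x ≡ false

  Degular : ℚ → Subset n → Subset n → Set
  Degular ε A B =
    Disjoint A B × (1 ℕ.≤ card A) × (1 ℕ.≤ card B) ×
    Σ (Subset n) λ A⁻ → Σ (Subset n) λ B⁻ →
      (A⁻ ⊆ A) × (B⁻ ⊆ B) ×
      (ℕtoℚ (card A⁻) ≤ ε * ℕtoℚ (card A)) ×
      (ℕtoℚ (card B⁻) ≤ ε * ℕtoℚ (card B)) ×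
      (∀ a → A a ≡ true → A⁻ a ≡ false →
         ∣ ℕtoℚ (deg a B) - divℕ (e A B) (card A) ∣ ≤ ε * ℕtoℚ (card B)) ×
      (∀ b → B b ≡ true → B⁻ b ≡ false →
         ∣ ℕtoℚ (deg b A) - divℕ (e A B) (card B) ∣ ≤ ε * ℕtoℚ (card A))

  part : {ℓ : ℕ} → (Fin n → Fin ℓ) → Fin ℓ → Subset n
  part {ℓ} p i v = does (p v Data.Fin.≟ i)
    where open import Relation.Nullary using (does)
          import Data.Fin

  DegularPartition : ℚ → (ℓ : ℕ) → (Fin n → Fin ℓ) → Set
  DegularPartition ε ℓ p =
    (∀ i j → card (part p i) ℕ.≤ suc (card (part p j))) ×
    (∀ i → Σ (Subset ℓ) λ J →
        ((1ℚ - ε) * ℕtoℚ ℓ ≤ ℕtoℚ (card J)) ×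
        (∀ j → J j ≡ true → (j ≢ i) × Degular ε (part p i) (part p j)))

  HasDegularPartition : ℚ → ℕ → Set
  HasDegularPartition ε ℓ = Σ (Fin n → Fin ℓ) λ p → DegularPartition ε ℓ p

-- D(ε) ≥ N : some finite graph G has an ε-degular partition, and every
-- ε-degular partition of G has complexity at least N (i.e. the minimum
-- complexity for G, which exists, is ≥ N; hence the supremum is ≥ N).
D≥ : ℚ → ℕ → Set
D≥ ε N = Σ Graph λ G →
  (∃ λ ℓ → HasDegularPartition G ε ℓ) ×
  (∀ ℓ → HasDegularPartition G ε ℓ → N ℕ.≤ ℓ)

-- tower function on naturals: towℕ 0 = 1, towℕ (k+1) = 2 ^ towℕ k.
-- For real x ≥ 0, tow(x) = towℕ ⌊x⌋.
towℕ : ℕ → ℕ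
towℕ zero    = 1
towℕ (suc k) = 2 ℕ.^ towℕ k

-- k ≤ c · ε^(-1/3)   (for c, ε > 0), written as k³ · ε ≤ c³
LeCε⁻¹ᐟ³ : ℕ → ℚ → ℚ → Set
LeCε⁻¹ᐟ³ k c ε = ℕtoℚ (k ℕ.* k ℕ.* k) * ε ≤ c * c * c

-- D(ε) ≥ tow(c · ε^(-1/3)); since tow x = towℕ ⌊x⌋ and towℕ is monotone,
-- this is: D(ε) ≥ towℕ k for every natural k ≤ c · ε^(-1/3).
D≥towCε⁻¹ᐟ³ : ℚ → ℚ → Set
D≥towCε⁻¹ᐟ³ c ε = ∀ k → LeCε⁻¹ᐟ³ k c ε → D≥ ε (towℕ k)

{-# OPTIONS --safe #-}
module Submission where

-- The vertices of the graph are testers and fillers. Testers come in types 0, …, k, and a tester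
-- of type t carries a label in a set of size mₜ, where mₜ₊₁ is exponential in mₜ. The labels of
-- type t + 1 are words of length mₜ of a code in which any two words differ in a quarter of the
-- positions, and a tester of type t + 1 is adjacent to a tester of type t iff its word has a one
-- at the position given by the label of the latter. Fillers only serve to give testers of
-- different types (and of different labels, for type 0) clearly different degrees.
--
-- In a degular partition, the vectors of degrees into the parts are nearly constant on the set of
-- typical vertices of each part, and all but few vertices are typical. Degrees are sums of such
-- vectors, so the typical testers of a part have one type. By induction on the type t they also
-- have one label: most labels of type t − 1 dominate some part, and if z and z′ of type t had
-- different labels, their degrees into a quarter of these parts would differ maximally. Hence a
-- part captures at most one label of type k, and there are at least mₖ / 2 parts.

open import Defs
open import Data.Rational using (ℚ; _<_; 0ℚ)
open import Data.Product using (Σ; _×_)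

import Algebra.Properties.Semiring.Sum
open import Data.Bool using (Bool; true; false; not; _∧_; _∨_; _xor_; if_then_else_; T)
open import Data.Bool.Properties using (∨-comm) renaming (_≟_ to _≟ᵇ_)
open import Data.Fin as Fin using (Fin; zero; suc; toℕ; fromℕ<; _↑ˡ_; _↑ʳ_; combine; splitAt; remQuot)
open import Data.Fin.Properties
  using (toℕ-injective; toℕ-fromℕ<; toℕ-combine; toℕ<n; nonZeroIndex; splitAt-↑ˡ; splitAt-↑ʳ; remQuot-combine; any?)
import Data.Integer as ℤ
import Data.Integer.Properties as ℤ
open import Data.List using (tabulate)
open import Data.List.Properties using (map-tabulate)
open import Data.Nat as ℕ hiding (_<_)
open import Data.Nat.Coprimality using (1-coprimeTo) renaming (sym to coprime-sym)
open import Data.Nat.DivMod using (_mod_; [m+kn]%n≡m%n; m<n⇒m%n≡m)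
open import Data.Nat.Divisibility using (_∣_; divides; ∣-trans; m∣m*n; n∣m*n; ∣⇒≤)
import Data.Nat.ListAction as List
open import Data.Nat.Properties
open import Data.Nat.Tactic.RingSolver using (solve-∀)
open import Data.Product using (∃; _,_; proj₁; proj₂)
open import Data.Rational as ℚ using (mkℚ; 1ℚ)
import Data.Rational.Properties as ℚ
import Data.Rational.Solver as ℚ
import Data.Rational.Unnormalised as ℚᵘ
import Data.Rational.Unnormalised.Properties as ℚᵘ
open import Data.Sum using (_⊎_; inj₁; inj₂; [_,_]′)
open import Data.Vec using (Vec; []; _∷_; lookup)
open import Function using (_∘_; id)
open import Relation.Binary.PropositionalEquality
open import Relation.Nullary using (does; yes; no; contradiction)
open import Relation.Nullary.Decidable using (_×-dec_; from-yes)

open import Algebra.Properties.CommutativeSemigroup *-commutativeSemigroup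
  using () renaming (x∙yz≈y∙xz to *-swap; interchange to *-interchange)
open import Algebra.Properties.CommutativeSemigroup +-commutativeSemigroup
  using () renaming (interchange to +-interchange)
module Lib = Algebra.Properties.Semiring.Sum +-*-semiring

-- Rational and natural inequalities

ℕtoℚ≡ : ∀ k → ℕtoℚ k ≡ mkℚ (ℤ.+ k) 0 (coprime-sym (1-coprimeTo k))
ℕtoℚ≡ k = ℚ.normalize-coprime (coprime-sym (1-coprimeTo k))

ℕtoℚ-cancel-≤ : ∀ a b → ℕtoℚ a ℚ.≤ ℕtoℚ b → a ≤ b
ℕtoℚ-cancel-≤ a b le with subst₂ ℚ._≤_ (ℕtoℚ≡ a) (ℕtoℚ≡ b) le
... | ℚ.*≤* a*1≤b*1 = ℤ.drop‿+≤+ (subst₂ ℤ._≤_ (ℤ.*-identityʳ (ℤ.+ a)) (ℤ.*-identityʳ (ℤ.+ b)) a*1≤b*1)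

ℕtoℚ-mono-≤ : ∀ {a b} → a ≤ b → ℕtoℚ a ℚ.≤ ℕtoℚ b
ℕtoℚ-mono-≤ {a} {b} a≤b = subst₂ ℚ._≤_ (sym (ℕtoℚ≡ a)) (sym (ℕtoℚ≡ b))
  (ℚ.*≤* (subst₂ ℤ._≤_ (sym (ℤ.*-identityʳ (ℤ.+ a))) (sym (ℤ.*-identityʳ (ℤ.+ b))) (ℤ.+≤+ a≤b)))

ℕtoℚ-+ : ∀ a b → ℕtoℚ (a + b) ≡ ℕtoℚ a ℚ.+ ℕtoℚ b
ℕtoℚ-+ a b = trans (ℚ./-cong (sym (cong₂ ℤ._+_ (ℤ.*-identityʳ (ℤ.+ a)) (ℤ.*-identityʳ (ℤ.+ b)))) refl)
  (sym (cong₂ ℚ._+_ (ℕtoℚ≡ a) (ℕtoℚ≡ b)))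

ℕtoℚ-* : ∀ a b → ℕtoℚ (a * b) ≡ ℕtoℚ a ℚ.* ℕtoℚ b
ℕtoℚ-* a b = trans (ℚ./-cong (ℤ.pos-* a b) refl) (sym (cong₂ ℚ._*_ (ℕtoℚ≡ a) (ℕtoℚ≡ b)))

ℕtoℚ-nonNeg : ∀ k → ℚ.NonNegative (ℕtoℚ k)
ℕtoℚ-nonNeg k = ℚ.normalize-nonNeg k 1

p≤∣p∣ : ∀ p → p ℚ.≤ ℚ.∣ p ∣
p≤∣p∣ (mkℚ (ℤ.+ _)      _ _) = ℚ.≤-refl
p≤∣p∣ (mkℚ (ℤ.-[1+ _ ]) _ _) = ℚ.*≤* ℤ.-≤+

one-short : ∀ ε {c n} → 1ℚ ℚ.≤ ε ℚ.* ℕtoℚ n → 1 + c ≡ n → (1ℚ ℚ.- ε) ℚ.* ℕtoℚ n ℚ.≤ ℕtoℚ c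
one-short ε {c} 1≤εn refl = begin
  (1ℚ ℚ.- ε) ℚ.* N            ≡⟨ solve 2 (λ e n → (con 1ℚ :- e) :* n := (n :- con 1ℚ) :+ (con 1ℚ :- e :* n)) refl ε N ⟩
  (N ℚ.- 1ℚ) ℚ.+ (1ℚ ℚ.- ε ℚ.* N)
                               ≤⟨ ℚ.+-monoʳ-≤ (N ℚ.- 1ℚ) (ℚ.+-monoˡ-≤ (ℚ.- (ε ℚ.* N)) 1≤εn) ⟩
  (N ℚ.- 1ℚ) ℚ.+ (ε ℚ.* N ℚ.- ε ℚ.* N)
                               ≡⟨ cong (λ x → (x ℚ.- 1ℚ) ℚ.+ (ε ℚ.* N ℚ.- ε ℚ.* N)) (ℕtoℚ-+ 1 c) ⟩
  (1ℚ ℚ.+ C ℚ.- 1ℚ) ℚ.+ (ε ℚ.* N ℚ.- ε ℚ.* N)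
                               ≡⟨ solve 2 (λ c x → (con 1ℚ :+ c :- con 1ℚ) :+ (x :- x) := c) refl C (ε ℚ.* N) ⟩
  C                            ∎
  where
  N = ℕtoℚ (1 + c)
  C = ℕtoℚ c
  open ℚ.≤-Reasoning
  open ℚ.+-*-Solver

-- Since `ε * M ≤ 1`, multiplying an `ε`-bound by `M` leaves an inequality between naturals.
module Scaling (ε : ℚ) (M : ℕ) (εM≤1 : ε ℚ.* ℕtoℚ M ℚ.≤ 1ℚ) where

  scale : ∀ b → ℕtoℚ M ℚ.* (ε ℚ.* ℕtoℚ b) ℚ.≤ ℕtoℚ b
  scale b = begin
    ℕtoℚ M ℚ.* (ε ℚ.* ℕtoℚ b)    ≡⟨ solve 3 (λ m e b → m :* (e :* b) := e :* m :* b) refl (ℕtoℚ M) ε (ℕtoℚ b) ⟩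
    ε ℚ.* ℕtoℚ M ℚ.* ℕtoℚ b      ≤⟨ ℚ.*-monoʳ-≤-nonNeg (ℕtoℚ b) {{ℕtoℚ-nonNeg b}} εM≤1 ⟩
    1ℚ ℚ.* ℕtoℚ b                ≡⟨ ℚ.*-identityˡ (ℕtoℚ b) ⟩
    ℕtoℚ b                        ∎
    where
    open ℚ.≤-Reasoning
    open ℚ.+-*-Solver

  small⇒ℕ : ∀ a b → ℕtoℚ a ℚ.≤ ε ℚ.* ℕtoℚ b → M * a ≤ b
  small⇒ℕ a b a≤εb = ℕtoℚ-cancel-≤ (M * a) b (begin
    ℕtoℚ (M * a)                  ≡⟨ ℕtoℚ-* M a ⟩
    ℕtoℚ M ℚ.* ℕtoℚ a             ≤⟨ ℚ.*-monoˡ-≤-nonNeg (ℕtoℚ M) {{ℕtoℚ-nonNeg M}} a≤εb ⟩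
    ℕtoℚ M ℚ.* (ε ℚ.* ℕtoℚ b)    ≤⟨ scale b ⟩
    ℕtoℚ b                        ∎)
    where open ℚ.≤-Reasoning

  -- Here `b` counts the indices outside the chosen set: a proportion of at least `1 - ε` inside
  -- leaves at most `ε * c` outside.
  complement⇒ℕ : ∀ a b {c} → a + b ≡ c → (1ℚ ℚ.- ε) ℚ.* ℕtoℚ c ℚ.≤ ℕtoℚ a → M * b ≤ c
  complement⇒ℕ a b refl le = small⇒ℕ b (a + b) (begin
    B                                        ≡⟨ solve 3 (λ a b e → b := (con 1ℚ :- e) :* (a :+ b) :+ (e :* (a :+ b) :- a)) refl A B ε ⟩
    (1ℚ ℚ.- ε) ℚ.* (A ℚ.+ B) ℚ.+ (ε ℚ.* (A ℚ.+ B) ℚ.- A)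
                                             ≡⟨ cong (λ x → (1ℚ ℚ.- ε) ℚ.* x ℚ.+ (ε ℚ.* x ℚ.- A)) (ℕtoℚ-+ a b) ⟨
    (1ℚ ℚ.- ε) ℚ.* C ℚ.+ (ε ℚ.* C ℚ.- A)   ≤⟨ ℚ.+-monoˡ-≤ _ le ⟩
    A ℚ.+ (ε ℚ.* C ℚ.- A)                   ≡⟨ solve 2 (λ a x → a :+ (x :- a) := x) refl A (ε ℚ.* C) ⟩
    ε ℚ.* C                                  ∎)
    where
    A = ℕtoℚ a
    B = ℕtoℚ b
    C = ℕtoℚ (a + b)
    open ℚ.≤-Reasoning
    open ℚ.+-*-Solver

  -- Both values lie within `ε * b` of `q`, so the triangle inequality eliminates `q`. In the
  -- application `q` is the average degree, the only term with a division.
  near⇒ℕ : ∀ x x′ b q → ℚ.∣ ℕtoℚ x ℚ.- q ∣ ℚ.≤ ε ℚ.* ℕtoℚ b → ℚ.∣ ℕtoℚ x′ ℚ.- q ∣ ℚ.≤ ε ℚ.* ℕtoℚ b →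
           M * x ≤ M * x′ + 2 * b
  near⇒ℕ x x′ b q near near′ = ℕtoℚ-cancel-≤ (M * x) (M * x′ + 2 * b) (begin
    ℕtoℚ (M * x)                                     ≡⟨ ℕtoℚ-* M x ⟩
    m ℚ.* X                                          ≡⟨ cong (m ℚ.*_) (solve 3 (λ x y q → x := y :+ ((x :- q) :+ (:- (y :- q)))) refl X X′ q) ⟩
    m ℚ.* (X′ ℚ.+ ((X ℚ.- q) ℚ.+ ℚ.- (X′ ℚ.- q)))   ≤⟨ ℚ.*-monoˡ-≤-nonNeg m {{ℕtoℚ-nonNeg M}} (ℚ.+-monoʳ-≤ X′ (ℚ.+-mono-≤ (upper near) lower)) ⟩
    m ℚ.* (X′ ℚ.+ (ε ℚ.* B ℚ.+ ε ℚ.* B))            ≡⟨ solve 3 (λ m x t → m :* (x :+ (t :+ t)) := m :* x :+ (m :* t :+ m :* t)) refl m X′ (ε ℚ.* B) ⟩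
    m ℚ.* X′ ℚ.+ (m ℚ.* (ε ℚ.* B) ℚ.+ m ℚ.* (ε ℚ.* B)) ≤⟨ ℚ.+-monoʳ-≤ (m ℚ.* X′) (ℚ.+-mono-≤ (scale b) (scale b)) ⟩
    m ℚ.* X′ ℚ.+ (B ℚ.+ B)                          ≡⟨ cong₂ ℚ._+_ (ℕtoℚ-* M x′) (ℕtoℚ-+ b b) ⟨
    ℕtoℚ (M * x′) ℚ.+ ℕtoℚ (b + b)                  ≡⟨ ℕtoℚ-+ (M * x′) (b + b) ⟨
    ℕtoℚ (M * x′ + (b + b))                          ≡⟨ cong (λ y → ℕtoℚ (M * x′ + (b + y))) (+-identityʳ b) ⟨
    ℕtoℚ (M * x′ + 2 * b)                            ∎)
    where
    m = ℕtoℚ M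
    X = ℕtoℚ x
    X′ = ℕtoℚ x′
    B = ℕtoℚ b
    open ℚ.≤-Reasoning
    open ℚ.+-*-Solver
    upper : ∀ {p} → ℚ.∣ p ∣ ℚ.≤ ε ℚ.* B → p ℚ.≤ ε ℚ.* B
    upper {p} = ℚ.≤-trans (p≤∣p∣ p)
    lower : ℚ.- (X′ ℚ.- q) ℚ.≤ ε ℚ.* B
    lower = upper (subst (ℚ._≤ ε ℚ.* B) (sym (ℚ.∣-p∣≡∣p∣ (X′ ℚ.- q))) near′)

-- A positive rational is at least the reciprocal of its denominator.
1≤ε*n : ∀ ε n → ℚ.Positive ε → ℚ.↧ₙ ε ≤ n → 1ℚ ℚ.≤ ε ℚ.* ℕtoℚ n
1≤ε*n ε@(mkℚ ℤ.+[1+ a ] d _) n _ d<n rewrite ℕtoℚ≡ n =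
  ℚ.toℚᵘ-cancel-≤ (ℚᵘ.≤-respʳ-≃ (ℚᵘ.≃-sym (ℚ.toℚᵘ-homo-* ε (mkℚ (ℤ.+ n) 0 (coprime-sym (1-coprimeTo n))))) (ℚᵘ.*≤* (begin
    ℤ.+ 1 ℤ.* ℤ.+ (suc d * 1)                 ≡⟨ trans (ℤ.*-identityˡ (ℤ.+ (suc d * 1))) (cong ℤ.+_ (*-identityʳ (suc d))) ⟩
    ℤ.+ suc d                                  ≤⟨ ℤ.+≤+ (≤-trans d<n (m≤n*m n (suc a))) ⟩
    ℤ.+ (suc a * n)                            ≡⟨ trans (ℤ.pos-* (suc a) n) (sym (ℤ.*-identityʳ _)) ⟩
    ℤ.+ suc a ℤ.* ℤ.+ n ℤ.* ℤ.+ 1             ∎)))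
  where open ℤ.≤-Reasoning

-- The constant `c₀` and the bound `ε * M ≤ 1`

c₀ : ℚ
c₀ = ℤ.+ 1 ℚ./ 1000

-- The number of classes of Q vertices of the graph: one for each tester type and four for each
-- possible rank; type 0 has 48 labels.
units : ℕ → ℕ
units k = suc k + 4 * (48 + suc k)

-- The two sides are equal: `c₀ = 1/1000` makes the left one `5 * 10^8 * 2 * 10^-9`.
c₀³-small : ℕtoℚ 500000000 ℚ.* (c₀ ℚ.* c₀ ℚ.* c₀ ℚ.+ c₀ ℚ.* c₀ ℚ.* c₀) ℚ.≤ 1ℚ
c₀³-small = from-yes (ℕtoℚ 500000000 ℚ.* (c₀ ℚ.* c₀ ℚ.* c₀ ℚ.+ c₀ ℚ.* c₀ ℚ.* c₀) ℚ.≤? 1ℚ)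

-- `units k` is linear in `k`, so its square is below a multiple of `k³ + 1`. This form fits the two
-- available bounds: `k³ε ≤ c₀³` for the cube and `ε < c₀³` for the one.
units²≤ : ∀ k → 3072 * (units k * units k) ≤ 500000000 * (k * k * k + 1)
units²≤ k = begin
  3072 * (units k * units k)                      ≤⟨ *-monoʳ-≤ 3072 (*-mono-≤ (linear k) (linear k)) ⟩
  3072 * (197 * suc k * (197 * suc k))            ≡⟨ cong (3072 *_) (square 197 (suc k)) ⟩
  3072 * (38809 * (suc k * suc k))                ≤⟨ *-monoʳ-≤ 3072 (*-monoʳ-≤ 38809 (cubic k)) ⟩
  3072 * (38809 * (4 * (k * k * k + 1)))          ≡⟨ flatten 3072 38809 4 (k * k * k + 1) ⟩
  476884992 * (k * k * k + 1)                     ≤⟨ *-monoˡ-≤ (k * k * k + 1) (≤ᵇ⇒≤ 476884992 500000000 _) ⟩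
  500000000 * (k * k * k + 1)                     ∎
  where
  open ≤-Reasoning
  linear : ∀ k → units k ≤ 197 * suc k
  linear k = ≤-trans (≤-reflexive (expand k)) (≤-trans (+-monoˡ-≤ 197 (*-monoˡ-≤ k (≤ᵇ⇒≤ 5 197 _))) (≤-reflexive (contract k)))
    where
    expand : ∀ k → suc k + 4 * (48 + suc k) ≡ 5 * k + 197
    expand = solve-∀
    contract : ∀ k → 197 * k + 197 ≡ 197 * suc k
    contract = solve-∀
  square : ∀ a b → a * b * (a * b) ≡ a * a * (b * b)
  square = solve-∀
  flatten : ∀ a b c x → a * (b * (c * x)) ≡ a * b * c * x
  flatten = solve-∀
  cubic : ∀ k → suc k * suc k ≤ 4 * (k * k * k + 1)
  cubic zero    = s≤s z≤n
  cubic (suc j) = subst (suc (suc j) * suc (suc j) ≤_) (expand j) (m≤m+n _ _)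
    where
    expand : ∀ j → suc (suc j) * suc (suc j) + (4 * (j * j * j) + 11 * (j * j) + 8 * j + 4) ≡ 4 * (suc j * suc j * suc j + 1)
    expand = solve-∀

ε*M≤1 : ∀ k ε → 0ℚ ℚ.< ε → ε ℚ.< c₀ ℚ.* c₀ ℚ.* c₀ → LeCε⁻¹ᐟ³ k c₀ ε → ε ℚ.* ℕtoℚ (3072 * (units k * units k)) ℚ.≤ 1ℚ
ε*M≤1 k ε 0<ε ε<c₀³ k³ε≤c₀³ = begin
  ε ℚ.* ℕtoℚ (3072 * (units k * units k))          ≤⟨ ℚ.*-monoˡ-≤-nonNeg ε {{ℚ.nonNegative (ℚ.<⇒≤ 0<ε)}} (ℕtoℚ-mono-≤ (units²≤ k)) ⟩
  ε ℚ.* ℕtoℚ (K * (k * k * k + 1))                 ≡⟨ cong (ε ℚ.*_) (trans (ℕtoℚ-* K (k * k * k + 1)) (cong (ℕtoℚ K ℚ.*_) (ℕtoℚ-+ (k * k * k) 1))) ⟩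
  ε ℚ.* (ℕtoℚ K ℚ.* (ℕtoℚ (k * k * k) ℚ.+ 1ℚ))    ≡⟨ solve 3 (λ e K x → e :* (K :* (x :+ con 1ℚ)) := K :* (x :* e :+ e)) refl ε (ℕtoℚ K) (ℕtoℚ (k * k * k)) ⟩
  ℕtoℚ K ℚ.* (ℕtoℚ (k * k * k) ℚ.* ε ℚ.+ ε)       ≤⟨ ℚ.*-monoˡ-≤-nonNeg (ℕtoℚ K) {{ℕtoℚ-nonNeg K}} (ℚ.+-mono-≤ k³ε≤c₀³ (ℚ.<⇒≤ ε<c₀³)) ⟩
  ℕtoℚ K ℚ.* (c₀ ℚ.* c₀ ℚ.* c₀ ℚ.+ c₀ ℚ.* c₀ ℚ.* c₀)    ≤⟨ c₀³-small ⟩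
  1ℚ                                                ∎
  where
  K = 500000000
  open ℚ.≤-Reasoning
  open ℚ.+-*-Solver

open ≤-Reasoning

-- Finite sums

-- The library's sum, made abstract because its summand cannot be inferred from its unfolding.
abstract
  sum : ∀ {m} → (Fin m → ℕ) → ℕ
  sum = Lib.sum

  sum-cong : ∀ {m} {f g : Fin m → ℕ} → (∀ i → f i ≡ g i) → sum f ≡ sum g
  sum-cong = Lib.sum-cong-≗

  sum-+ : ∀ {m} (f g : Fin m → ℕ) → sum (λ i → f i + g i) ≡ sum f + sum g
  sum-+ = Lib.∑-distrib-+

  *-sum : ∀ {m} c (f : Fin m → ℕ) → c * sum f ≡ sum (λ i → c * f i)
  *-sum = Lib.*-distribˡ-sum

  sum-* : ∀ {m} (f : Fin m → ℕ) c → sum f * c ≡ sum (λ i → f i * c)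
  sum-* f c = Lib.*-distribʳ-sum c f

  sum-comm : ∀ {m n} (f : Fin m → Fin n → ℕ) →
             sum (λ i → sum (λ j → f i j)) ≡ sum (λ j → sum (λ i → f i j))
  sum-comm = Lib.∑-comm

  sum-zero : (f : Fin 0 → ℕ) → sum f ≡ 0
  sum-zero f = refl

  sum-suc : ∀ {m} (f : Fin (suc m) → ℕ) → sum f ≡ f zero + sum (f ∘ suc)
  sum-suc f = refl

  sumFin≡sum : ∀ m (f : Fin m → ℕ) → sumFin m f ≡ sum f
  sumFin≡sum m f = trans (cong List.sum (map-tabulate id f)) (go m f)
    where
    go : ∀ m (f : Fin m → ℕ) → List.sum (tabulate f) ≡ sum f
    go zero    f = refl
    go (suc m) f = cong (f zero +_) (go m (f ∘ suc))

  sum-const : ∀ m c → sum {m} (λ _ → c) ≡ m * c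
  sum-const zero    c = refl
  sum-const (suc m) c = cong (c +_) (sum-const m c)

  sum-mono-≤ : ∀ {m} {f g : Fin m → ℕ} → (∀ i → f i ≤ g i) → sum f ≤ sum g
  sum-mono-≤ {zero}  f≤g = z≤n
  sum-mono-≤ {suc m} f≤g = +-mono-≤ (f≤g zero) (sum-mono-≤ (f≤g ∘ suc))

  sum-++ : ∀ m {n} (f : Fin (m + n) → ℕ) → sum f ≡ sum (f ∘ (_↑ˡ n)) + sum (f ∘ (m ↑ʳ_))
  sum-++ zero    f = refl
  sum-++ (suc m) f = trans (cong (f zero +_) (sum-++ m (f ∘ suc))) (sym (+-assoc (f zero) _ _))

  sum-combine : ∀ m {n} (f : Fin (m * n) → ℕ) → sum f ≡ sum λ i → sum λ j → f (combine {m} {n} i j)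
  sum-combine zero    f = refl
  sum-combine (suc m) {n} f = trans (sum-++ n f) (cong (sum (f ∘ (_↑ˡ m * n)) +_) (sum-combine m (f ∘ (n ↑ʳ_))))

  sum-pick : ∀ {m} (a : Fin m) (g : Fin m → ℕ) → sum (λ j → bit (does (a Fin.≟ j)) * g j) ≡ g a
  sum-pick {suc m} zero g = begin-equality
    g zero + 0 + sum {m} (λ _ → 0)  ≡⟨ cong₂ _+_ (+-identityʳ _) (trans (sum-const m 0) (*-zeroʳ m)) ⟩
    g zero + 0                      ≡⟨ +-identityʳ _ ⟩
    g zero                          ∎
  sum-pick {suc m} (suc a) g = sum-pick a (g ∘ suc)

  term≤sum : ∀ {m} (f : Fin m → ℕ) i → f i ≤ sum f
  term≤sum f zero    = m≤m+n _ _
  term≤sum f (suc i) = ≤-trans (term≤sum (f ∘ suc) i) (m≤n+m _ (f zero))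

sum-mono-const : ∀ {m} {f : Fin m → ℕ} c → (∀ i → f i ≤ c) → sum f ≤ m * c
sum-mono-const {m} {f} c f≤c = subst (sum f ≤_) (sum-const m c) (sum-mono-≤ f≤c)

bit≤1 : ∀ b → bit b ≤ 1
bit≤1 true  = ≤-refl
bit≤1 false = z≤n

bit-∧ : ∀ a b → bit (a ∧ b) ≡ bit a * bit b
bit-∧ true  b = sym (+-identityʳ (bit b))
bit-∧ false b = refl

bit-∨ : ∀ a b → bit (a ∨ b) ≤ bit a + bit b
bit-∨ true  b = s≤s z≤n
bit-∨ false b = ≤-refl

bit+not : ∀ a → bit a + bit (not a) ≡ 1
bit+not true  = refl
bit+not false = refl

sum-bit+not : ∀ {m} (S : Fin m → Bool) → sum (bit ∘ S) + sum (bit ∘ not ∘ S) ≡ m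
sum-bit+not {m} S = begin-equality
  sum (bit ∘ S) + sum (bit ∘ not ∘ S)  ≡⟨ sum-+ _ _ ⟨
  sum (λ i → bit (S i) + bit (not (S i)))  ≡⟨ sum-cong (bit+not ∘ S) ⟩
  sum {m} (λ _ → 1)  ≡⟨ trans (sum-const m 1) (*-identityʳ m) ⟩
  m ∎

-- Each `w` is counted in exactly one part, namely `p w`. This splits global counts over the parts.
sum-fibres : ∀ {n ℓ} (p : Fin n → Fin ℓ) (f : Fin n → ℕ) →
             sum f ≡ sum λ j → sum λ w → bit (does (p w Fin.≟ j)) * f w
sum-fibres p f = begin-equality
  sum f                                                    ≡⟨ sum-cong (λ w → sum-pick (p w) (λ _ → f w)) ⟨
  (sum λ w → sum λ j → bit (does (p w Fin.≟ j)) * f w)    ≡⟨ sum-comm _ ⟩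
  (sum λ j → sum λ w → bit (does (p w Fin.≟ j)) * f w)    ∎

sum-∣-∣ : ∀ {m} (f g : Fin m → ℕ) → sum f ≤ sum g + sum (λ i → ∣ f i - g i ∣)
sum-∣-∣ f g = subst (sum f ≤_) (sum-+ g _) (sum-mono-≤ λ i → m≤n+∣m-n∣ (f i) (g i))

mod-combine : ∀ {q} m .{{_ : NonZero m}} (i : Fin q) (j : Fin m) → toℕ (combine i j) mod m ≡ j
mod-combine m i j = toℕ-injective (begin-equality
  toℕ (toℕ (combine i j) mod m)    ≡⟨ toℕ-fromℕ< _ ⟩
  toℕ (combine i j) % m            ≡⟨ cong (_% m) (toℕ-combine i j) ⟩
  (m * toℕ i + toℕ j) % m          ≡⟨ cong (_% m) (trans (+-comm _ (toℕ j)) (cong (toℕ j +_) (*-comm m _))) ⟩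
  (toℕ j + toℕ i * m) % m          ≡⟨ [m+kn]%n≡m%n (toℕ j) (toℕ i) m ⟩
  toℕ j % m                        ≡⟨ m<n⇒m%n≡m (toℕ<n j) ⟩
  toℕ j                            ∎)

-- As `m` divides `Q`, each residue occurs `Q / m` times; the factor `m` on the left avoids the
-- division.
sum-mod : ∀ {Q} m .{{_ : NonZero m}} → m ∣ Q → (g : Fin m → ℕ) →
          m * sum {Q} (λ x → g (toℕ x mod m)) ≡ Q * sum g
sum-mod m (divides q refl) g = begin-equality
  m * sum (λ x → g (toℕ x mod m))                             ≡⟨ cong (m *_) (sum-combine q _) ⟩
  m * sum (λ i → sum λ j → g (toℕ (combine {q} i j) mod m))  ≡⟨ cong (m *_) (sum-cong λ i → sum-cong λ j → cong g (mod-combine m i j)) ⟩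
  m * sum {q} (λ _ → sum g)                                   ≡⟨ cong (m *_) (sum-const q _) ⟩
  m * (q * sum g)                                             ≡⟨ rearrange m q (sum g) ⟩
  q * m * sum g                                               ∎
  where
  rearrange : ∀ m q s → m * (q * s) ≡ q * m * s
  rearrange = solve-∀

-- Binary codes

sumWords : ∀ m → (Vec Bool m → ℕ) → ℕ
sumWords zero    f = f []
sumWords (suc m) f = sumWords m (f ∘ (false ∷_)) + sumWords m (f ∘ (true ∷_))

sumWords-cong : ∀ m {f g} → (∀ w → f w ≡ g w) → sumWords m f ≡ sumWords m g
sumWords-cong zero    f≡g = f≡g []
sumWords-cong (suc m) f≡g = cong₂ _+_ (sumWords-cong m (f≡g ∘ _)) (sumWords-cong m (f≡g ∘ _))

sumWords-* : ∀ m c f → sumWords m (λ w → c * f w) ≡ c * sumWords m f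
sumWords-* zero    c f = refl
sumWords-* (suc m) c f =
  trans (cong₂ _+_ (sumWords-* m c _) (sumWords-* m c _)) (sym (*-distribˡ-+ c _ _))

sumWords-+ : ∀ m f g → sumWords m (λ w → f w + g w) ≡ sumWords m f + sumWords m g
sumWords-+ zero    f g = refl
sumWords-+ (suc m) f g =
  trans (cong₂ _+_ (sumWords-+ m _ _) (sumWords-+ m _ _)) (+-interchange (sumWords m (f ∘ (false ∷_))) _ _ _)

sumWords-0 : ∀ m → sumWords m (λ _ → 0) ≡ 0
sumWords-0 zero    = refl
sumWords-0 (suc m) = cong₂ _+_ (sumWords-0 m) (sumWords-0 m)

sumWords-sum : ∀ m {N} (f : Fin N → Vec Bool m → ℕ) →
               sumWords m (λ w → sum λ b → f b w) ≡ sum (λ b → sumWords m (f b))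
sumWords-sum m {zero}  f = trans (sumWords-cong m (λ w → sum-zero _)) (trans (sumWords-0 m) (sym (sum-zero _)))
sumWords-sum m {suc N} f = begin-equality
  sumWords m (λ w → sum λ b → f b w)                                      ≡⟨ sumWords-cong m (λ w → sum-suc _) ⟩
  sumWords m (λ w → f zero w + sum (λ b → f (suc b) w))                   ≡⟨ sumWords-+ m _ _ ⟩
  sumWords m (f zero) + sumWords m (λ w → sum (λ b → f (suc b) w))        ≡⟨ cong (sumWords m (f zero) +_) (sumWords-sum m (f ∘ suc)) ⟩
  sumWords m (f zero) + sum (λ b → sumWords m (f (suc b)))                ≡⟨ sum-suc _ ⟨
  sum (λ b → sumWords m (f b))                                            ∎

-- The word is found letter by letter: if the total exceeds its share `2 ^ m * K` on the words
-- starting with `false`, it is below that share on the others.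
below-average : ∀ m f K → sumWords m f ℕ.< 2 ^ m * K → ∃ λ w → f w ℕ.< K
below-average zero    f K f< = [] , subst (f [] ℕ.<_) (+-identityʳ K) f<
below-average (suc m) f K f< with sumWords m (f ∘ (false ∷_)) <? 2 ^ m * K
... | yes f₀< = let w , fw< = below-average m _ K f₀< in false ∷ w , fw<
... | no  f₀≮ = let w , fw< = below-average m _ K (+-cancelˡ-< (2 ^ m * K) _ _ f₁<) in true ∷ w , fw<
  where
  double : ∀ a K → 2 * a * K ≡ a * K + a * K
  double = solve-∀
  f₁< : 2 ^ m * K + sumWords m (f ∘ (true ∷_)) ℕ.< 2 ^ m * K + 2 ^ m * K
  f₁< = ≤-<-trans (+-monoˡ-≤ _ (≮⇒≥ f₀≮)) (subst (sumWords (suc m) f ℕ.<_) (double (2 ^ m) K) f<)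

agreement : Bool → Bool → ℕ
agreement a b = if a xor b then 1 else 2

-- Equals 2 to the number of agreeing positions, an exponential potential whose sum over all words
-- factorises.
weight : ∀ {m} → Vec Bool m → Vec Bool m → ℕ
weight []      []      = 1
weight (a ∷ v) (b ∷ w) = agreement a b * weight v w

distance : ∀ {m} → Vec Bool m → Vec Bool m → ℕ
distance v w = sum λ i → bit (lookup v i xor lookup w i)

-- Every position contributes the factor `1 + 2`, whatever the letter of `v`.
sumWords-weight : ∀ {m} (v : Vec Bool m) → sumWords m (weight v) ≡ 3 ^ m
sumWords-weight []      = refl
sumWords-weight {suc m} (a ∷ v) = begin-equality
  sumWords m (λ w → agreement a false * weight v w) + sumWords m (λ w → agreement a true * weight v w)
    ≡⟨ cong₂ _+_ (sumWords-* m (agreement a false) _) (sumWords-* m (agreement a true) _) ⟩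
  agreement a false * sumWords m (weight v) + agreement a true * sumWords m (weight v)
    ≡⟨ *-distribʳ-+ (sumWords m (weight v)) (agreement a false) (agreement a true) ⟨
  (agreement a false + agreement a true) * sumWords m (weight v)
    ≡⟨ cong₂ _*_ (three a) (sumWords-weight v) ⟩
  3 ^ suc m ∎
  where
  three : ∀ a → agreement a false + agreement a true ≡ 3
  three true  = refl
  three false = refl

weight*2^distance : ∀ {m} (v w : Vec Bool m) → weight v w * 2 ^ distance v w ≡ 2 ^ m
weight*2^distance []      []      = cong (λ d → 1 * 2 ^ d) (sum-zero _)
weight*2^distance {suc m} (a ∷ v) (b ∷ w) = begin-equality
  agreement a b * weight v w * 2 ^ distance (a ∷ v) (b ∷ w)
    ≡⟨ cong (λ d → agreement a b * weight v w * 2 ^ d) (sum-suc _) ⟩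
  agreement a b * weight v w * 2 ^ (bit (a xor b) + distance v w)
    ≡⟨ cong (agreement a b * weight v w *_) (^-distribˡ-+-* 2 (bit (a xor b)) _) ⟩
  agreement a b * weight v w * (2 ^ bit (a xor b) * 2 ^ distance v w)
    ≡⟨ *-interchange (agreement a b) (weight v w) (2 ^ bit (a xor b)) _ ⟩
  agreement a b * 2 ^ bit (a xor b) * (weight v w * 2 ^ distance v w)
    ≡⟨ cong₂ _*_ (two (a xor b)) (weight*2^distance v w) ⟩
  2 ^ suc m ∎
  where
  two : ∀ c → (if c then 1 else 2) * 2 ^ bit c ≡ 2
  two true  = refl
  two false = refl

weight-sym : ∀ {m} (v w : Vec Bool m) → weight v w ≡ weight w v
weight-sym []      []      = refl
weight-sym (a ∷ v) (b ∷ w) = cong₂ _*_ (agreement-sym a b) (weight-sym v w)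
  where
  agreement-sym : ∀ a b → agreement a b ≡ agreement b a
  agreement-sym true  true  = refl
  agreement-sym true  false = refl
  agreement-sym false true  = refl
  agreement-sym false false = refl

-- A weight below `2 ^ (6 * r)` means fewer than `6 * r` agreements among `8 * r` positions.
light⇒distant : ∀ r (v w : Vec Bool (8 * r)) → weight v w ℕ.< 2 ^ (6 * r) → 2 * r ≤ distance v w
light⇒distant r v w wt< = <⇒≤ (2^-cancel-< _ _ (*-cancelˡ-< (2 ^ (6 * r)) _ _ (begin-strict
  2 ^ (6 * r) * 2 ^ (2 * r)         ≡⟨ ^-distribˡ-+-* 2 (6 * r) (2 * r) ⟨
  2 ^ (6 * r + 2 * r)               ≡⟨ cong (2 ^_) (sym (*-distribʳ-+ r 6 2)) ⟩
  2 ^ (8 * r)                       ≡⟨ weight*2^distance v w ⟨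
  weight v w * 2 ^ distance v w     <⟨ *-monoˡ-< (2 ^ distance v w) {{m^n≢0 2 (distance v w)}} wt< ⟩
  2 ^ (6 * r) * 2 ^ distance v w    ∎)))
  where
  2^-cancel-< : ∀ a b → 2 ^ a ℕ.< 2 ^ b → a ℕ.< b
  2^-cancel-< a b lt with a <? b
  ... | yes a<b = a<b
  ... | no  a≮b = contradiction lt (≤⇒≯ (^-monoʳ-≤ 2 (≮⇒≥ a≮b)))

^-distrib-* : ∀ a b r → (a * b) ^ r ≡ a ^ r * b ^ r
^-distrib-* a b zero    = refl
^-distrib-* a b (suc r) = trans (cong (a * b *_) (^-distrib-* a b r)) (*-interchange a b (a ^ r) (b ^ r))

record Code (m N d : ℕ) : Set where
  field
    word     : Fin N → Vec Bool m
    distant  : ∀ b b′ → b ≢ b′ → d ≤ distance (word b) (word b′)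
open Code

-- Greedy choice: a uniformly random word has expected total weight N · 3^(8r) / 2^(8r)
-- against the N words chosen so far, which is less than 2^(6r) because 2 · 3^8 < 2^14.
module _ (r : ℕ) where

  Light : ∀ {N} → (Fin N → Vec Bool (8 * r)) → Set
  Light c = ∀ b b′ → b ≢ b′ → weight (c b) (c b′) ℕ.< 2 ^ (6 * r)

  room : ∀ N → N ℕ.< 2 ^ r → N * 3 ^ (8 * r) ℕ.< 2 ^ (8 * r) * 2 ^ (6 * r)
  room N N< = begin-strict
    N * 3 ^ (8 * r)              <⟨ *-monoˡ-< (3 ^ (8 * r)) {{m^n≢0 3 (8 * r)}} N< ⟩
    2 ^ r * 3 ^ (8 * r)          ≡⟨ cong (2 ^ r *_) (sym (^-*-assoc 3 8 r)) ⟩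
    2 ^ r * (3 ^ 8) ^ r          ≡⟨ ^-distrib-* 2 (3 ^ 8) r ⟨
    13122 ^ r                    ≤⟨ ^-monoˡ-≤ r (≤ᵇ⇒≤ 13122 16384 _) ⟩
    (2 ^ 14) ^ r                 ≡⟨ ^-*-assoc 2 14 r ⟩
    2 ^ (14 * r)                 ≡⟨ cong (2 ^_) (*-distribʳ-+ r 8 6) ⟩
    2 ^ (8 * r + 6 * r)          ≡⟨ ^-distribˡ-+-* 2 (8 * r) (6 * r) ⟩
    2 ^ (8 * r) * 2 ^ (6 * r)    ∎

  greedy : ∀ N → N ≤ 2 ^ r → Σ (Fin N → Vec Bool (8 * r)) Light
  greedy zero    N≤ = (λ ()) , λ ()
  greedy (suc N) N< = extended , light
    where
    c = proj₁ (greedy N (<⇒≤ N<))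
    total : sumWords (8 * r) (λ w → sum λ b → weight (c b) w) ≡ N * 3 ^ (8 * r)
    total = trans (sumWords-sum (8 * r) (weight ∘ c)) (trans (sum-cong (sumWords-weight ∘ c)) (sum-const N _))
    new = below-average (8 * r) _ _ (subst (ℕ._< 2 ^ (8 * r) * 2 ^ (6 * r)) (sym total) (room N N<))
    extended : Fin (suc N) → Vec Bool (8 * r)
    extended zero    = proj₁ new
    extended (suc b) = c b
    new-light : ∀ b → weight (c b) (proj₁ new) ℕ.< 2 ^ (6 * r)
    -- Weights are natural numbers, so the bound on their total holds for each of them.
    new-light b = ≤-<-trans (term≤sum _ b) (proj₂ new)
    light : Light extended
    light zero    zero     b≢b′ = contradiction refl b≢b′
    light zero    (suc b′) b≢b′ = subst (ℕ._< 2 ^ (6 * r)) (weight-sym (c b′) (proj₁ new)) (new-light b′)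
    light (suc b) zero     b≢b′ = new-light b
    light (suc b) (suc b′) b≢b′ = proj₂ (greedy N (<⇒≤ N<)) b b′ (b≢b′ ∘ cong suc)

  code : ∀ {N} → N ≤ 2 ^ r → Code (8 * r) N (2 * r)
  code N≤ = let c , light = greedy _ N≤ in record
    { word    = c
    ; distant = λ b b′ b≢b′ → light⇒distant r (c b) (c b′) (light b b′ b≢b′)
    }

-- Typical vertices of a regular partition

∣-∣-least : ∀ a b {c} → a ≤ b + c → b ≤ a + c → ∣ a - b ∣ ≤ c
∣-∣-least a b a≤ b≤ with ∣m-n∣≡[m∸n]∨[n∸m] a b
... | inj₁ eq = subst (_≤ _) (sym eq) (m≤n+o⇒m∸n≤o a b a≤)
... | inj₂ eq = subst (_≤ _) (sym eq) (m≤n+o⇒m∸n≤o b a b≤)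

≤ᵇ-sound : ∀ a b → (a ≤ᵇ b) ≡ true → a ≤ b
≤ᵇ-sound a b t = ≤ᵇ⇒≤ a b (subst T (sym t) _)

markov : ∀ a b → bit (not (a ≤ᵇ b)) * b ≤ a
markov a b with a ≤ᵇ b in eq
... | true  = z≤n
... | false = subst (_≤ a) (sym (+-identityʳ b)) (≰⇒≥ λ a≤b → subst T eq (≤⇒≤ᵇ a≤b))

module _ {n ℓ : ℕ} (adj : Fin n → Fin n → Bool) (p : Fin n → Fin ℓ) where

  member : Fin ℓ → Fin n → ℕ
  member j w = bit (does (p w Fin.≟ j))

  size : Fin ℓ → ℕ
  size j = sum (member j)

  degInto : Fin n → Fin ℓ → ℕ
  degInto z j = sum λ w → member j w * bit (adj z w)

  deviation : Fin n → Fin n → ℕ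
  deviation z z′ = sum λ j → ∣ degInto z j - degInto z′ j ∣

  -- What is used of degularity, with 1 / M in place of ε and without division.
  record Regular (M : ℕ) : Set where
    field
      good            : Fin ℓ → Fin ℓ → Bool
      exceptional     : Fin ℓ → Fin ℓ → Fin n → Bool
      equitable       : ∀ i j → size i ≤ suc (size j)
      few-bad         : ∀ i → M * sum (λ j → bit (not (good i j))) ≤ ℓ
      few-exceptional : ∀ i j → good i j ≡ true → M * sum (bit ∘ exceptional i j) ≤ size i
      near            : ∀ i j → good i j ≡ true → ∀ z z′ → p z ≡ i → p z′ ≡ i →
                        exceptional i j z ≡ false → exceptional i j z′ ≡ false →
                        M * degInto z j ≤ M * degInto z′ j + 2 * size j

  sum-size : sum size ≡ n
  sum-size = begin-equality
    sum size                                  ≡⟨ sum-cong (λ j → sum-cong λ w → *-identityʳ (member j w)) ⟨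
    sum (λ j → sum λ w → member j w * 1)     ≡⟨ sum-fibres p (λ _ → 1) ⟨
    sum {n} (λ _ → 1)                         ≡⟨ trans (sum-const n 1) (*-identityʳ n) ⟩
    n                                         ∎

  degInto≤size : ∀ z j → degInto z j ≤ size j
  degInto≤size z j = sum-mono-≤ λ w → ≤-trans (*-monoʳ-≤ (member j w) (bit≤1 (adj z w))) (≤-reflexive (*-identityʳ _))

  -- The bound has the form `size j + 0` because that is what `1 * size j` computes to in
  -- `deviation-into`.
  crude : ∀ z z′ j → ∣ degInto z j - degInto z′ j ∣ ≤ size j + 0
  crude z z′ j = ≤-trans (∣m-n∣≤m⊔n (degInto z j) _)
    (≤-trans (⊔-lub (degInto≤size z j) (degInto≤size z′ j)) (m≤m+n _ 0))

  module Profile {M : ℕ} (R : Regular M) (ℓ≤n : ℓ ≤ n) where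
    open Regular R

    -- Compare part `j` with all parts. The rounding adds `ℓ` in total, and `ℓ ≤ n` turns this into
    -- a factor 2.
    ℓ*size≤2n : ∀ j → ℓ * size j ≤ 2 * n
    ℓ*size≤2n j = begin
      ℓ * size j                     ≡⟨ sum-const ℓ (size j) ⟨
      sum {ℓ} (λ _ → size j)         ≤⟨ sum-mono-≤ (equitable j) ⟩
      sum (λ i → 1 + size i)         ≡⟨ sum-+ (λ _ → 1) size ⟩
      sum {ℓ} (λ _ → 1) + sum size   ≡⟨ cong₂ _+_ (trans (sum-const ℓ 1) (*-identityʳ ℓ)) sum-size ⟩
      ℓ + n                          ≤⟨ +-mono-≤ ℓ≤n (m≤m+n n 0) ⟩
      2 * n                          ∎

    -- Few bad indices carry few vertices, as no part exceeds `2n / ℓ`. Dividing by `ℓ` is possible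
    -- because `i` inhabits `Fin ℓ`.
    bad-mass : ∀ i → M * sum (λ j → bit (not (good i j)) * size j) ≤ 2 * n
    bad-mass i = *-cancelˡ-≤ ℓ {{nonZeroIndex i}} (begin
      ℓ * (M * sum (λ j → b j * size j))       ≡⟨ *-swap ℓ M _ ⟩
      M * (ℓ * sum (λ j → b j * size j))       ≡⟨ cong (M *_) (*-sum ℓ _) ⟩
      M * sum (λ j → ℓ * (b j * size j))       ≡⟨ cong (M *_) (sum-cong λ j → *-swap ℓ (b j) _) ⟩
      M * sum (λ j → b j * (ℓ * size j))       ≤⟨ *-monoʳ-≤ M (sum-mono-≤ λ j → *-monoʳ-≤ (b j) (ℓ*size≤2n j)) ⟩
      M * sum (λ j → b j * (2 * n))            ≡⟨ cong (M *_) (sum-* b (2 * n)) ⟨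
      M * (sum b * (2 * n))                    ≡⟨ *-assoc M _ _ ⟨
      M * sum b * (2 * n)                      ≤⟨ *-monoˡ-≤ (2 * n) (few-bad i) ⟩
      ℓ * (2 * n)                              ∎)
      where
      b = λ j → bit (not (good i j))

    strays : Fin n → Fin ℓ → Bool
    strays z j = good (p z) j ∧ exceptional (p z) j z

    -- Group `z` by its part `i`: if the pair `(i, j)` is good, at most `size i / M` vertices of
    -- part `i` are exceptional for it, and these bounds add up to `n / M`.
    stray-count : ∀ j → M * sum (λ z → bit (strays z j)) ≤ n
    stray-count j = begin
      M * sum (λ z → bit (strays z j))                              ≡⟨ cong (M *_) (sum-fibres p _) ⟩
      M * sum (λ i → sum λ z → member i z * bit (strays z j))      ≤⟨ *-monoʳ-≤ M (sum-mono-≤ λ i → sum-mono-≤ (pointwise i)) ⟩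
      M * sum (λ i → sum λ z → bit (good i j) * bit (exceptional i j z))
                                                                    ≡⟨ cong (M *_) (sum-cong λ i → *-sum (bit (good i j)) (bit ∘ exceptional i j)) ⟨
      M * sum (λ i → bit (good i j) * sum (bit ∘ exceptional i j))  ≡⟨ *-sum M _ ⟩
      sum (λ i → M * (bit (good i j) * sum (bit ∘ exceptional i j))) ≤⟨ sum-mono-≤ per-part ⟩
      sum size                                                      ≡⟨ sum-size ⟩
      n                                                             ∎
      where
      pointwise : ∀ i z → member i z * bit (strays z j) ≤ bit (good i j) * bit (exceptional i j z)
      pointwise i z with p z Fin.≟ i
      ... | no  _    = z≤n
      ... | yes refl = ≤-reflexive (trans (+-identityʳ _) (bit-∧ (good i j) _))
      per-part : ∀ i → M * (bit (good i j) * sum (bit ∘ exceptional i j)) ≤ size i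
      per-part i with good i j in eq
      ... | true  = subst (λ x → M * x ≤ size i) (sym (+-identityʳ _)) (few-exceptional i j eq)
      ... | false = subst (_≤ size i) (sym (*-zeroʳ M)) z≤n

    bad : Fin n → Fin ℓ → Bool
    bad z j = not (good (p z) j) ∨ strays z j

    -- The number of vertices in those parts into which the degree of `z` is not controlled.
    excess : Fin n → ℕ
    excess z = sum λ j → bit (bad z j) * size j

    -- Pairs that are not good cost each `z` at most `2n / M` by `bad-mass`. For strays the order of
    -- summation is exchanged, and `stray-count` bounds them part by part, at `n² / M` altogether.
    excess-total : M * sum excess ≤ 3 * (n * n)
    excess-total = begin
      M * sum excess                                                  ≤⟨ *-monoʳ-≤ M (sum-mono-≤ split) ⟩
      M * sum (λ z → α z + β z)                                       ≡⟨ cong (M *_) (sum-+ α β) ⟩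
      M * (sum α + sum β)                                             ≡⟨ *-distribˡ-+ M _ _ ⟩
      M * sum α + M * sum β                                           ≤⟨ +-mono-≤ α-total β-total ⟩
      n * (2 * n) + n * n                                             ≡⟨ three n ⟩
      3 * (n * n)                                                     ∎
      where
      α β : Fin n → ℕ
      α z = sum λ j → bit (not (good (p z) j)) * size j
      β z = sum λ j → bit (strays z j) * size j
      three : ∀ n → n * (2 * n) + n * n ≡ 3 * (n * n)
      three = solve-∀
      split : ∀ z → excess z ≤ α z + β z
      split z = begin
        excess z  ≤⟨ sum-mono-≤ (λ j → *-monoˡ-≤ (size j) (bit-∨ (not (good (p z) j)) (strays z j))) ⟩
        sum (λ j → (bit (not (good (p z) j)) + bit (strays z j)) * size j)
                  ≡⟨ sum-cong (λ j → *-distribʳ-+ (size j) (bit (not (good (p z) j))) _) ⟩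
        sum (λ j → bit (not (good (p z) j)) * size j + bit (strays z j) * size j)
                  ≡⟨ sum-+ _ (λ j → bit (strays z j) * size j) ⟩
        α z + β z ∎
      α-total : M * sum α ≤ n * (2 * n)
      α-total = subst (_≤ n * (2 * n)) (sym (*-sum M α)) (sum-mono-const (2 * n) λ z → bad-mass (p z))
      β-total : M * sum β ≤ n * n
      β-total = begin
        M * sum β                                                 ≡⟨ cong (M *_) (sum-comm λ z j → bit (strays z j) * size j) ⟩
        M * sum (λ j → sum λ z → bit (strays z j) * size j)      ≡⟨ cong (M *_) (sum-cong λ j → sum-* (λ z → bit (strays z j)) (size j)) ⟨
        M * sum (λ j → sum (λ z → bit (strays z j)) * size j)    ≡⟨ *-sum M _ ⟩
        sum (λ j → M * (sum (λ z → bit (strays z j)) * size j))  ≡⟨ sum-cong (λ j → sym (*-assoc M _ (size j))) ⟩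
        sum (λ j → M * sum (λ z → bit (strays z j)) * size j)    ≤⟨ sum-mono-≤ (λ j → *-monoˡ-≤ (size j) (stray-count j)) ⟩
        sum (λ j → n * size j)                                    ≡⟨ *-sum n size ⟨
        n * sum size                                              ≡⟨ cong (n *_) sum-size ⟩
        n * n                                                     ∎

    not-bad : ∀ z j → bad z j ≡ false → good (p z) j ≡ true × exceptional (p z) j z ≡ false
    not-bad z j with good (p z) j | exceptional (p z) j z
    ... | true | false = λ _ → refl , refl

    -- If part `j` is bad for `z` or `z′`, the trivial bound `size j` is charged to the excess;
    -- otherwise `near` applies in both directions.
    deviation-into : ∀ z z′ → p z ≡ p z′ → ∀ j → M * ∣ degInto z j - degInto z′ j ∣ ≤
                     2 * size j + M * (bit (bad z j) * size j + bit (bad z′ j) * size j)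
    deviation-into z z′ pz≡pz′ j with bad z j in b | bad z′ j in b′
    ... | true  | _     = ≤-trans (*-monoʳ-≤ M (crude z z′ j)) (≤-trans (*-monoʳ-≤ M (m≤m+n _ _)) (m≤n+m _ (2 * size j)))
    ... | false | true  = ≤-trans (*-monoʳ-≤ M (crude z z′ j)) (m≤n+m _ (2 * size j))
    ... | false | false = begin
      M * ∣ degInto z j - degInto z′ j ∣         ≡⟨ *-distribˡ-∣-∣ M (degInto z j) _ ⟩
      ∣ M * degInto z j - M * degInto z′ j ∣     ≤⟨ ∣-∣-least (M * degInto z j) _
                                                      (near _ j g z z′ refl (sym pz≡pz′) x x″)
                                                      (near _ j g z′ z (sym pz≡pz′) refl x″ x) ⟩
      2 * size j                                 ≤⟨ m≤m+n _ _ ⟩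
      2 * size j + M * 0                         ∎
      where
      g = proj₁ (not-bad z j b)
      x = proj₂ (not-bad z j b)
      x″ = subst (λ i → exceptional i j z′ ≡ false) (sym pz≡pz′) (proj₂ (not-bad z′ j b′))

    deviation-bound : ∀ z z′ → p z ≡ p z′ → M * deviation z z′ ≤ 2 * n + M * (excess z + excess z′)
    deviation-bound z z′ pz≡pz′ = begin
      M * deviation z z′                                      ≡⟨ *-sum M _ ⟩
      sum (λ j → M * ∣ degInto z j - degInto z′ j ∣)         ≤⟨ sum-mono-≤ (deviation-into z z′ pz≡pz′) ⟩
      sum (λ j → 2 * size j + M * (x z j + x z′ j))          ≡⟨ sum-+ (λ j → 2 * size j) (λ j → M * (x z j + x z′ j)) ⟩
      sum (λ j → 2 * size j) + sum (λ j → M * (x z j + x z′ j))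
                                                              ≡⟨ cong₂ _+_ (*-sum 2 size) (*-sum M (λ j → x z j + x z′ j)) ⟨
      2 * sum size + M * sum (λ j → x z j + x z′ j)          ≡⟨ cong₂ (λ a b → 2 * a + M * b) sum-size (sum-+ (x z) (x z′)) ⟩
      2 * n + M * (excess z + excess z′)                      ∎
      where
      x : Fin n → Fin ℓ → ℕ
      x z j = bit (bad z j) * size j

    -- The constants make the final count work: the typical deviation plus twice the number of
    -- atypical vertices is at most 5Q / 32, less than the Q / 4 vertices that separate two labels.
    module Typical (Q U : ℕ) {{_ : NonZero Q}} {{_ : NonZero U}} (n≡ : n ≡ U * Q) (M≡ : M ≡ 3072 * (U * U)) where

      typical : Fin n → Bool
      typical z = 32 * excess z ≤ᵇ Q

      -- Markov's inequality: an atypical vertex has `excess` above `Q / 32`, while all excesses sum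
      -- to at most `3n² / M = Q² / 1024`.
      atypical-few : 32 * sum (λ z → bit (not (typical z))) ≤ Q
      atypical-few = *-cancelˡ-≤ (96 * (U * U) * Q) {{divisor≢0}} (begin
        96 * (U * U) * Q * (32 * A)           ≡⟨ rearrange₁ U Q A ⟩
        3072 * (U * U) * (A * Q)              ≡⟨ cong (_* (A * Q)) M≡ ⟨
        M * (A * Q)                           ≡⟨ cong (M *_) (sum-* _ Q) ⟩
        M * sum (λ z → bit (not (typical z)) * Q)  ≤⟨ *-monoʳ-≤ M (sum-mono-≤ λ z → markov (32 * excess z) Q) ⟩
        M * sum (λ z → 32 * excess z)         ≡⟨ cong (M *_) (*-sum 32 excess) ⟨
        M * (32 * sum excess)                 ≡⟨ *-swap M 32 (sum excess) ⟩
        32 * (M * sum excess)                 ≤⟨ *-monoʳ-≤ 32 excess-total ⟩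
        32 * (3 * (n * n))                    ≡⟨ cong (λ n → 32 * (3 * (n * n))) n≡ ⟩
        32 * (3 * (U * Q * (U * Q)))          ≡⟨ rearrange₂ U Q ⟩
        96 * (U * U) * Q * Q                  ∎)
        where
        A = sum λ z → bit (not (typical z))
        divisor≢0 : NonZero (96 * (U * U) * Q)
        divisor≢0 = m*n≢0 (96 * (U * U)) Q {{m*n≢0 96 (U * U) {{_}} {{m*n≢0 U U}}}}
        rearrange₁ : ∀ U Q A → 96 * (U * U) * Q * (32 * A) ≡ 3072 * (U * U) * (A * Q)
        rearrange₁ = solve-∀
        rearrange₂ : ∀ U Q → 32 * (3 * (U * Q * (U * Q))) ≡ 96 * (U * U) * Q * Q
        rearrange₂ = solve-∀

      -- Each of the two excesses contributes at most `Q / 32`, and so does the term `2n / M` left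
      -- by the controlled parts.
      typical⇒deviation-small : ∀ z z′ → typical z ≡ true → typical z′ ≡ true → p z ≡ p z′ →
                                32 * deviation z z′ ≤ 3 * Q
      typical⇒deviation-small z z′ tz tz′ pz≡pz′ = *-cancelˡ-≤ M {{M≢0}} (begin
        M * (32 * deviation z z′)                          ≡⟨ *-swap M 32 (deviation z z′) ⟩
        32 * (M * deviation z z′)                          ≤⟨ *-monoʳ-≤ 32 (deviation-bound z z′ pz≡pz′) ⟩
        32 * (2 * n + M * (excess z + excess z′))          ≡⟨ rearrange n M (excess z) (excess z′) ⟩
        64 * n + M * (32 * excess z + 32 * excess z′)      ≤⟨ +-mono-≤ 64n≤MQ (*-monoʳ-≤ M (+-mono-≤ (≤ᵇ-sound (32 * excess z) Q tz) (≤ᵇ-sound (32 * excess z′) Q tz′))) ⟩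
        M * Q + M * (Q + Q)                                ≡⟨ collect M Q ⟩
        M * (3 * Q)                                        ∎)
        where
        M≢0 : NonZero M
        M≢0 = subst NonZero (sym M≡) (m*n≢0 3072 (U * U) {{_}} {{m*n≢0 U U}})
        64n≤MQ : 64 * n ≤ M * Q
        64n≤MQ = begin
          64 * n                 ≡⟨ cong (64 *_) n≡ ⟩
          64 * (U * Q)           ≡⟨ *-assoc 64 U Q ⟨
          64 * U * Q             ≤⟨ *-monoˡ-≤ Q (*-mono-≤ (≤ᵇ⇒≤ 64 3072 _) (m≤n*m U U)) ⟩
          3072 * (U * U) * Q     ≡⟨ cong (_* Q) M≡ ⟨
          M * Q                  ∎
        rearrange : ∀ n M x y → 32 * (2 * n + M * (x + y)) ≡ 64 * n + M * (32 * x + 32 * y)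
        rearrange = solve-∀
        collect : ∀ M Q → M * Q + M * (Q + Q) ≡ M * (3 * Q)
        collect = solve-∀

-- From degular partitions to `Regular`

module Transfer (ε : ℚ) (M : ℕ) (εM≤1 : ε ℚ.* ℕtoℚ M ℚ.≤ 1ℚ) (G : Graph) where
  open Graph G using (n; adj)
  open Scaling ε M εM≤1

  HalfRegular : Subset n → Subset n → Subset n → Set
  HalfRegular A B X = M * card X ≤ card A ×
    (∀ z z′ → A z ≡ true → A z′ ≡ true → X z ≡ false → X z′ ≡ false →
     M * deg G z B ≤ M * deg G z′ B + 2 * card B)

  degular⇒half : ∀ A B → Degular G ε A B → Σ (Subset n) (HalfRegular A B)
  degular⇒half A B (_ , _ , _ , A⁻ , _ , _ , _ , |A⁻|≤ , _ , near , _) =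
    A⁻ , small⇒ℕ (card A⁻) (card A) |A⁻|≤ , λ z z′ Az Az′ A⁻z A⁻z′ → near⇒ℕ (deg G z B) (deg G z′ B) (card B) (divℕ (e G A B) (card A)) (near z Az A⁻z) (near z′ Az′ A⁻z′)

  -- Degularity supplies an exceptional set only for good pairs; the default for the others is the
  -- empty set. The flag is a separate argument so that it can be matched on together with its
  -- evidence.
  exceptionalIf : ∀ {A B} b → (b ≡ true → Degular G ε A B) → Subset n
  exceptionalIf true  d = proj₁ (degular⇒half _ _ (d refl))
  exceptionalIf false d = λ _ → false

  exceptionalIf-half : ∀ {A B} b (d : b ≡ true → Degular G ε A B) → b ≡ true → HalfRegular A B (exceptionalIf b d)
  exceptionalIf-half true d _ = proj₂ (degular⇒half _ _ (d refl))

  size≡card : ∀ {ℓ} (p : Fin n → Fin ℓ) j → card (part G p j) ≡ size adj p j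
  size≡card p j = sumFin≡sum n _

  degInto≡deg : ∀ {ℓ} (p : Fin n → Fin ℓ) z j → deg G z (part G p j) ≡ degInto adj p z j
  degInto≡deg p z j = trans (sumFin≡sum n _) (sum-cong λ w → bit-∧ (does (p w Fin.≟ j)) (adj z w))

  part-true : ∀ {ℓ} (p : Fin n → Fin ℓ) j z → p z ≡ j → part G p j z ≡ true
  part-true p j z pz with p z Fin.≟ j
  ... | yes _  = refl
  ... | no  ≢j = contradiction pz ≢j

  degular⇒Regular : ∀ {ℓ} (p : Fin n → Fin ℓ) → DegularPartition G ε ℓ p → Regular adj p M
  degular⇒Regular {ℓ} p (equitable , most) = record
    { good            = good
    ; exceptional     = X
    ; equitable       = λ i j → subst₂ (λ a b → a ≤ suc b) (size≡card p i) (size≡card p j) (equitable i j)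
    ; few-bad         = λ i → complement⇒ℕ (sum (bit ∘ good i)) _ (sum-bit+not (good i))
                          (subst (λ c → (1ℚ ℚ.- ε) ℚ.* ℕtoℚ ℓ ℚ.≤ ℕtoℚ c) (sumFin≡sum ℓ _) (proj₁ (proj₂ (most i))))
    ; few-exceptional = λ i j g → subst₂ (λ a b → M * a ≤ b) (sumFin≡sum n _) (size≡card p i) (proj₁ (half i j g))
    ; near            = λ i j g z z′ pz pz′ Xz Xz′ →
                          subst₂ (λ a b → M * a ≤ M * b + 2 * size adj p j) (degInto≡deg p z j) (degInto≡deg p z′ j)
                            (subst (λ c → M * deg G z (part G p j) ≤ M * deg G z′ (part G p j) + 2 * c) (size≡card p j)
                              (proj₂ (half i j g) z z′ (part-true p i z pz) (part-true p i z′ pz′) Xz Xz′))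
    }
    where
    good : Fin ℓ → Fin ℓ → Bool
    good i = proj₁ (most i)
    degular : ∀ i j → good i j ≡ true → Degular G ε (part G p i) (part G p j)
    degular i j g = proj₂ (proj₂ (proj₂ (most i)) j g)
    X : Fin ℓ → Fin ℓ → Subset n
    X i j = exceptionalIf (good i j) (degular i j)
    half : ∀ i j → good i j ≡ true → HalfRegular (part G p i) (part G p j) (X i j)
    half i j = exceptionalIf-half (good i j) (degular i j)

-- Existence of a degular partition: the singletons

module Singletons (G : Graph) (ε : ℚ) (0<ε : 0ℚ ℚ.< ε) where
  open Graph G using (n; adj) renaming (sym to adj-sym)

  does-≟-sym : ∀ {m} (i j : Fin m) → does (i Fin.≟ j) ≡ does (j Fin.≟ i)
  does-≟-sym i j with i Fin.≟ j | j Fin.≟ i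
  ... | yes _   | yes _   = refl
  ... | no _    | no _    = refl
  ... | yes i≡j | no j≢i  = contradiction (sym i≡j) j≢i
  ... | no i≢j  | yes j≡i = contradiction (sym j≡i) i≢j

  singleton : Fin n → Subset n
  singleton = part G id

  sum-singleton : ∀ i (g : Fin n → Bool) → sum (λ w → bit (singleton i w ∧ g w)) ≡ bit (g i)
  sum-singleton i g = begin-equality
    sum (λ w → bit (does (w Fin.≟ i) ∧ g w))          ≡⟨ sum-cong (λ w → cong (λ b → bit (b ∧ g w)) (does-≟-sym w i)) ⟩
    sum (λ w → bit (does (i Fin.≟ w) ∧ g w))          ≡⟨ sum-cong (λ w → bit-∧ (does (i Fin.≟ w)) (g w)) ⟩
    sum (λ w → bit (does (i Fin.≟ w)) * bit (g w))    ≡⟨ sum-pick i (bit ∘ g) ⟩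
    bit (g i)                                          ∎

  card-singleton : ∀ i → card (singleton i) ≡ 1
  card-singleton i = begin-equality
    card (singleton i)                        ≡⟨ sumFin≡sum n _ ⟩
    sum (λ w → bit (singleton i w))           ≡⟨ sum-cong (λ w → ∧-true (singleton i w)) ⟩
    sum (λ w → bit (singleton i w ∧ true))    ≡⟨ sum-singleton i (λ _ → true) ⟩
    1                                         ∎
    where
    ∧-true : ∀ b → bit b ≡ bit (b ∧ true)
    ∧-true true  = refl
    ∧-true false = refl

  deg-singleton : ∀ v i → deg G v (singleton i) ≡ bit (adj v i)
  deg-singleton v i = trans (sumFin≡sum n _) (sum-singleton i (adj v))

  e-singleton : ∀ i j → e G (singleton i) (singleton j) ≡ bit (adj i j)
  e-singleton i j = begin-equality
    e G (singleton i) (singleton j)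
      ≡⟨ trans (sumFin≡sum n _) (sum-cong λ a → sumFin≡sum n _) ⟩
    sum (λ a → sum λ b → bit (singleton i a ∧ (singleton j b ∧ adj a b)))
      ≡⟨ sum-comm _ ⟩
    sum (λ b → sum λ a → bit (singleton i a ∧ (singleton j b ∧ adj a b)))
      ≡⟨ sum-cong (λ b → sum-singleton i λ a → singleton j b ∧ adj a b) ⟩
    sum (λ b → bit (singleton j b ∧ adj i b))
      ≡⟨ sum-singleton j (adj i) ⟩
    bit (adj i j) ∎

  singleton-sound : ∀ i x → singleton i x ≡ true → x ≡ i
  singleton-sound i x t with x Fin.≟ i | t
  ... | yes x≡i | _ = x≡i

  0≤ε* : ∀ k → 0ℚ ℚ.≤ ε ℚ.* ℕtoℚ k
  0≤ε* k = ℚ.nonNegative⁻¹ _ {{ℚ.nonNeg*nonNeg⇒nonNeg ε {{ℚ.nonNegative (ℚ.<⇒≤ 0<ε)}} (ℕtoℚ k) {{ℕtoℚ-nonNeg k}}}}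

  no-exceptions : ∀ k → ℕtoℚ (card {n} (λ _ → false)) ℚ.≤ ε ℚ.* ℕtoℚ k
  no-exceptions k = subst (λ c → ℕtoℚ c ℚ.≤ ε ℚ.* ℕtoℚ k) (sym empty) (0≤ε* k)
    where
    empty : card {n} (λ _ → false) ≡ 0
    empty = trans (sumFin≡sum n _) (trans (sum-const n 0) (*-zeroʳ n))

  exact : ∀ x y c k → x ≡ y → c ≡ 1 → ℚ.∣ ℕtoℚ x ℚ.- divℕ y c ∣ ℚ.≤ ε ℚ.* ℕtoℚ k
  exact x .x .1 k refl refl = subst (λ q → ℚ.∣ q ∣ ℚ.≤ ε ℚ.* ℕtoℚ k) (sym (ℚ.+-inverseʳ (ℕtoℚ x))) (0≤ε* k)

  -- Between two single vertices, degree and average degree are the same bit, so all deviations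
  -- vanish and both exceptional sets can be empty.
  degular-singletons : ∀ i j → i ≢ j → Degular G ε (singleton i) (singleton j)
  degular-singletons i j i≢j =
    disjoint , ≤-reflexive (sym (card-singleton i)) , ≤-reflexive (sym (card-singleton j)) ,
    (λ _ → false) , (λ _ → false) , (λ _ ()) , (λ _ ()) , no-exceptions |A| , no-exceptions |B| ,
    (λ a Aa _ → exact (deg G a B) |AB| |A| |B| (trans (cong (λ v → deg G v _) (singleton-sound i a Aa)) (trans (deg-singleton i j) (sym (e-singleton i j)))) (card-singleton i)) ,
    (λ b Bb _ → exact (deg G b A) |AB| |B| |A| (trans (cong (λ v → deg G v _) (singleton-sound j b Bb))
                  (trans (deg-singleton j i) (trans (cong bit (adj-sym j i)) (sym (e-singleton i j))))) (card-singleton j))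
    where
    A = singleton i
    B = singleton j
    |A| = card A
    |B| = card B
    |AB| = e G A B
    disjoint : Disjoint G (singleton i) (singleton j)
    disjoint x xi with x Fin.≟ j
    ... | no _    = refl
    ... | yes x≡j = contradiction (trans (sym (singleton-sound i x xi)) x≡j) i≢j

  hasDegularPartition : 1ℚ ℚ.≤ ε ℚ.* ℕtoℚ n → HasDegularPartition G ε n
  hasDegularPartition 1≤εn = id ,
    (λ i j → subst₂ (λ a b → a ≤ suc b) (sym (card-singleton i)) (sym (card-singleton j)) (s≤s z≤n)) ,
    λ i → others i , enough i , λ j Jj → other-sound i j Jj , degular-singletons i j (other-sound i j Jj ∘ sym)
    where
    others : Fin n → Subset n
    others i j = not (singleton i j)
    other-sound : ∀ i j → others i j ≡ true → j ≢ i
    other-sound i j t j≡i with j Fin.≟ i | t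
    ... | no j≢i | _ = j≢i j≡i
    count : ∀ i → 1 + card (others i) ≡ n
    count i = begin-equality
      1 + card (others i)                          ≡⟨ cong₂ _+_ (card-singleton i) refl ⟨
      card (singleton i) + card (others i)         ≡⟨ cong₂ _+_ (sumFin≡sum n _) (sumFin≡sum n _) ⟩
      sum (bit ∘ singleton i) + sum (bit ∘ others i) ≡⟨ sum-bit+not (singleton i) ⟩
      n                                            ∎
    enough : ∀ i → (1ℚ ℚ.- ε) ℚ.* ℕtoℚ n ℚ.≤ ℕtoℚ (card (others i))
    enough i = one-short ε 1≤εn (count i)

-- The graph and its regular partitions

sum-unique : ∀ {m} (S : Fin m → Bool) → (∀ i j → S i ≡ true → S j ≡ true → i ≡ j) → sum (bit ∘ S) ≤ 1
sum-unique {zero}  S unique = subst (_≤ 1) (sym (sum-zero _)) z≤n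
sum-unique {suc m} S unique = subst (_≤ 1) (sym (sum-suc _)) (cases (S zero) refl)
  where
  suc-injective′ : ∀ {i j : Fin m} → Fin.suc i ≡ suc j → i ≡ j
  suc-injective′ refl = refl
  cases : ∀ b → S zero ≡ b → bit b + sum (bit ∘ S ∘ suc) ≤ 1
  cases false _ = sum-unique (S ∘ suc) λ i j Si Sj → suc-injective′ (unique (suc i) (suc j) Si Sj)
  cases true S₀ = s≤s (≤-trans (sum-mono-const 0 none) (≤-reflexive (*-zeroʳ m)))
    where
    none : ∀ i → bit (S (suc i)) ≤ 0
    none i with S (suc i) in Sᵢ
    ... | false = z≤n
    ... | true  with () ← unique zero (suc i) S₀ Sᵢ

sum-< : ∀ {m} c → c ≤ m → sum {m} (λ i → bit (toℕ i <ᵇ c)) ≡ c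
sum-< {m}     zero    _       = trans (sum-const m 0) (*-zeroʳ m)
sum-< {suc m} (suc c) (s≤s c≤m) = trans (sum-suc _) (cong suc (sum-< c c≤m))

≡ᵇ-sound : ∀ a b → (a ≡ᵇ b) ≡ true → a ≡ b
≡ᵇ-sound a b t = ≡ᵇ⇒≡ a b (subst T (sym t) _)

≡ᵇ-refl : ∀ a → (a ≡ᵇ a) ≡ true
≡ᵇ-refl zero    = refl
≡ᵇ-refl (suc a) = ≡ᵇ-refl a

1+a≢ᵇa : ∀ a → (suc a ≡ᵇ a) ≡ false
1+a≢ᵇa zero    = refl
1+a≢ᵇa (suc a) = 1+a≢ᵇa a

2+a≢ᵇa : ∀ a → (suc (suc a) ≡ᵇ a) ≡ false
2+a≢ᵇa zero    = refl
2+a≢ᵇa (suc a) = 2+a≢ᵇa a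

-- `s` is the number of tester types, `Q` the size of each class, `m t` the number of labels of type
-- `t`. Divisibility makes all labels of a type equally frequent in a class.
module Construction
  (s Q : ℕ) (m d : ℕ → ℕ) {{m≢0 : ∀ {t} → NonZero (m t)}} {{Q≢0 : NonZero Q}}
  (code : ∀ t → Code (m t) (m (suc t)) (d t)) (m≤4d : ∀ t → m t ≤ 4 * d t)
  (m∣Q : ∀ t → t ℕ.< s → m t ∣ Q) where

  -- F counts the classes of fillers, four for each possible rank.
  F n : ℕ
  F = 4 * (m 0 + s)
  n = (s + F) * Q

  label : ∀ t → Fin Q → Fin (m t)
  label t x = toℕ x mod m t

  -- Adjacency of x of type t to y of type t + 1.
  test : ℕ → Fin Q → Fin Q → Bool
  test t x y = lookup (Code.word (code t) (label (suc t) y)) (label t x)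

  -- The test relation made symmetric: at most one disjunct can hold, depending on which of the two
  -- types is the higher.
  link : ℕ → ℕ → Fin Q → Fin Q → Bool
  link i j x y = ((suc i ≡ᵇ j) ∧ test i x y) ∨ ((suc j ≡ᵇ i) ∧ test j y x)

  -- A tester of rank ρ is adjacent to exactly 4ρ classes of fillers, and to at most 2Q testers,
  -- so that ranks can be read off degrees. Type 0 has no tests and needs a rank per label.
  rank : ℕ → Fin Q → ℕ
  rank zero    x = toℕ (label 0 x)
  rank (suc i) x = m 0 + i

  Role : Set
  Role = Fin s ⊎ Fin F

  joined : Role → Fin Q → Role → Fin Q → Bool
  joined (inj₁ i) x (inj₁ j) y = link (toℕ i) (toℕ j) x y
  joined (inj₁ i) x (inj₂ f) y = toℕ f <ᵇ 4 * rank (toℕ i) x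
  joined (inj₂ f) x (inj₁ j) y = toℕ f <ᵇ 4 * rank (toℕ j) y
  joined (inj₂ _) x (inj₂ _) y = false

  role : Fin n → Role
  role v = splitAt s (proj₁ (remQuot {s + F} Q v))

  pos : Fin n → Fin Q
  pos v = proj₂ (remQuot {s + F} Q v)

  adj : Fin n → Fin n → Bool
  adj v w = joined (role v) (pos v) (role w) (pos w)

  joined-sym : ∀ a x b y → joined a x b y ≡ joined b y a x
  joined-sym (inj₁ i) x (inj₁ j) y = ∨-comm ((suc (toℕ i) ≡ᵇ toℕ j) ∧ test (toℕ i) x y) _
  joined-sym (inj₁ i) x (inj₂ f) y = refl
  joined-sym (inj₂ f) x (inj₁ j) y = refl
  joined-sym (inj₂ _) x (inj₂ _) y = refl

  joined-irrefl : ∀ a x → joined a x a x ≡ false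
  joined-irrefl (inj₁ i) x rewrite 1+a≢ᵇa (toℕ i) = refl
  joined-irrefl (inj₂ f) x = refl

  G : Graph
  G = record
    { n      = n
    ; adj    = adj
    ; sym    = λ u v → joined-sym (role u) (pos u) (role v) (pos v)
    ; irrefl = λ v → joined-irrefl (role v) (pos v)
    }

  sum-vertices : (g : Role → Fin Q → ℕ) → sum (λ v → g (role v) (pos v)) ≡
                 sum (λ i → sum (g (inj₁ i))) + sum (λ f → sum (g (inj₂ f)))
  sum-vertices g = begin-equality
    sum (λ v → g (role v) (pos v))                            ≡⟨ sum-combine (s + F) _ ⟩
    sum (λ u → sum λ x → g′ (remQuot Q (combine {s + F} u x)))  ≡⟨ sum-cong (λ u → sum-cong λ x → cong g′ (remQuot-combine u x)) ⟩
    sum (λ u → sum (g (splitAt s u)))                         ≡⟨ sum-++ s _ ⟩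
    sum (λ i → sum (g (splitAt s (i ↑ˡ F)))) + sum (λ f → sum (g (splitAt s (s ↑ʳ f))))
      ≡⟨ cong₂ _+_ (sum-cong λ i → cong (sum ∘ g) (splitAt-↑ˡ s i F)) (sum-cong λ f → cong (sum ∘ g) (splitAt-↑ʳ s F f)) ⟩
    sum (λ i → sum (g (inj₁ i))) + sum (λ f → sum (g (inj₂ f)))  ∎
    where
    g′ : Fin (s + F) × Fin Q → ℕ
    g′ (u , x) = g (splitAt s u) x

  degree : Fin n → ℕ
  degree z = sum λ w → bit (adj z w)

  -- There are enough filler classes for every rank, so the filler degree is exactly `4 * rank * Q`
  -- and is not truncated.
  rank-bound : ∀ (i : Fin s) x → 4 * rank (toℕ i) x ≤ F
  rank-bound i x = *-monoʳ-≤ 4 (bound (toℕ i) (<⇒≤ (toℕ<n i)))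
    where
    bound : ∀ t → t ≤ s → rank t x ≤ m 0 + s
    bound zero    t≤s = ≤-trans (<⇒≤ (toℕ<n (label 0 x))) (m≤m+n _ _)
    bound (suc t) t<s = +-monoʳ-≤ (m 0) (<⇒≤ t<s)

  -- Fillers give the main term. Links only reach the next and the previous type, each a single
  -- class of `Q` vertices.
  tester-degree : ∀ z i → role z ≡ inj₁ i →
    4 * rank (toℕ i) (pos z) * Q ≤ degree z × degree z ≤ 4 * rank (toℕ i) (pos z) * Q + 2 * Q
  tester-degree z i rz = lower , upper
    where
    x = pos z
    c = 4 * rank (toℕ i) x
    links fillers : ℕ
    links   = sum λ j → sum λ y → bit (link (toℕ i) (toℕ j) x y)
    fillers = sum {F} λ f → sum {Q} λ y → bit (toℕ f <ᵇ c)
    degree≡ : degree z ≡ links + fillers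
    degree≡ = trans (cong (λ r → sum λ w → bit (joined r x (role w) (pos w))) rz)
                    (sum-vertices λ b y → bit (joined (inj₁ i) x b y))
    fillers≡ : fillers ≡ c * Q
    fillers≡ = begin-equality
      fillers                                   ≡⟨ sum-cong (λ f → sum-const Q _) ⟩
      sum {F} (λ f → Q * bit (toℕ f <ᵇ c))     ≡⟨ *-sum Q (λ f → bit (toℕ f <ᵇ c)) ⟨
      Q * sum {F} (λ f → bit (toℕ f <ᵇ c))     ≡⟨ cong (Q *_) (sum-< c (rank-bound i x)) ⟩
      Q * c                                     ≡⟨ *-comm Q c ⟩
      c * Q                                     ∎
    next prev : Fin s → Bool
    next j = suc (toℕ i) ≡ᵇ toℕ j
    prev j = suc (toℕ j) ≡ᵇ toℕ i
    link≤ : ∀ j y → bit (link (toℕ i) (toℕ j) x y) ≤ bit (next j) + bit (prev j)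
    link≤ j y = ≤-trans (bit-∨ (next j ∧ test (toℕ i) x y) _) (+-mono-≤ (∧≤ (next j) _) (∧≤ (prev j) _))
      where
      ∧≤ : ∀ a b → bit (a ∧ b) ≤ bit a
      ∧≤ true  b = bit≤1 b
      ∧≤ false b = z≤n
    links≤ : links ≤ 2 * Q
    links≤ = begin
      links                                                       ≤⟨ sum-mono-≤ (λ j → sum-mono-const _ (link≤ j)) ⟩
      sum (λ j → Q * (bit (next j) + bit (prev j)))              ≡⟨ *-sum Q (λ j → bit (next j) + bit (prev j)) ⟨
      Q * sum (λ j → bit (next j) + bit (prev j))                ≡⟨ cong (Q *_) (sum-+ (bit ∘ next) (bit ∘ prev)) ⟩
      Q * (sum (bit ∘ next) + sum (bit ∘ prev))                  ≤⟨ *-monoʳ-≤ Q (+-mono-≤ (sum-unique next next-unique) (sum-unique prev prev-unique)) ⟩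
      Q * 2                                                       ≡⟨ *-comm Q 2 ⟩
      2 * Q                                                       ∎
      where
      next-unique : ∀ j j′ → next j ≡ true → next j′ ≡ true → j ≡ j′
      next-unique j j′ t t′ = toℕ-injective (trans (sym (≡ᵇ-sound (suc (toℕ i)) _ t)) (≡ᵇ-sound (suc (toℕ i)) _ t′))
      prev-unique : ∀ j j′ → prev j ≡ true → prev j′ ≡ true → j ≡ j′
      prev-unique j j′ t t′ = toℕ-injective (suc-injective (trans (≡ᵇ-sound _ (toℕ i) t) (sym (≡ᵇ-sound _ (toℕ i) t′))))
    lower : c * Q ≤ degree z
    lower = subst (c * Q ≤_) (sym (trans degree≡ (cong (links +_) fillers≡))) (m≤n+m _ links)
    upper : degree z ≤ c * Q + 2 * Q
    upper = subst (_≤ c * Q + 2 * Q) (sym (trans degree≡ (trans (cong (links +_) fillers≡) (+-comm links _)))) (+-monoʳ-≤ (c * Q) links≤)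

  -- Typical testers sharing a part agree in type and label

  module Rigidity {ℓ} (p : Fin n → Fin ℓ) (typical : Fin n → Bool)
    (atypical-few : 32 * sum (λ z → bit (not (typical z))) ≤ Q)
    (deviation-small : ∀ z z′ → typical z ≡ true → typical z′ ≡ true → p z ≡ p z′ →
                       32 * deviation adj p z z′ ≤ 3 * Q) where

    degree-stable : ∀ z z′ → degree z ≤ degree z′ + deviation adj p z z′
    degree-stable z z′ = subst₂ _≤_ (into z) (cong (_+ deviation adj p z z′) (into z′)) (sum-∣-∣ (degInto adj p z) (degInto adj p z′))
      where
      into : ∀ z → sum (degInto adj p z) ≡ degree z
      into z = sym (sum-fibres p λ w → bit (adj z w))

    -- A larger rank brings at least `4Q` more filler neighbours. Links blur this by at most `2Q`,
    -- and degrees of typical vertices of one part differ by at most `3Q / 32`.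
    rank-mono : ∀ z z′ i i′ → typical z ≡ true → typical z′ ≡ true → p z ≡ p z′ →
                role z ≡ inj₁ i → role z′ ≡ inj₁ i′ → rank (toℕ i) (pos z) ≤ rank (toℕ i′) (pos z′)
    -- After multiplication by 32 the contradiction has a margin of `128 - 64 - 3 = 61` copies of
    -- `Q`.
    rank-mono z z′ i i′ tz tz′ pz≡pz′ rz rz′ = ≮⇒≥ λ ρ′<ρ → <⇒≱ (61Q>0) (+-cancelˡ-≤ (128 * ρ′ * Q + 67 * Q) _ _ (begin
      128 * ρ′ * Q + 67 * Q + 61 * Q           ≡⟨ e₁ ρ′ Q ⟩
      32 * (4 * suc ρ′ * Q)                    ≤⟨ *-monoʳ-≤ 32 (*-monoˡ-≤ Q (*-monoʳ-≤ 4 ρ′<ρ)) ⟩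
      32 * (4 * ρ * Q)                         ≤⟨ *-monoʳ-≤ 32 (proj₁ (tester-degree z i rz)) ⟩
      32 * degree z                            ≤⟨ *-monoʳ-≤ 32 (degree-stable z z′) ⟩
      32 * (degree z′ + δ)                     ≡⟨ *-distribˡ-+ 32 (degree z′) δ ⟩
      32 * degree z′ + 32 * δ                  ≤⟨ +-mono-≤ (*-monoʳ-≤ 32 (proj₂ (tester-degree z′ i′ rz′))) (deviation-small z z′ tz tz′ pz≡pz′) ⟩
      32 * (4 * ρ′ * Q + 2 * Q) + 3 * Q        ≡⟨ e₂ ρ′ Q ⟩
      128 * ρ′ * Q + 67 * Q + 0                ∎))
      where
      ρ = rank (toℕ i) (pos z)
      ρ′ = rank (toℕ i′) (pos z′)
      δ = deviation adj p z z′
      61Q>0 : 0 ℕ.< 61 * Q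
      61Q>0 = >-nonZero⁻¹ (61 * Q) {{m*n≢0 61 Q}}
      e₁ : ∀ ρ Q → 128 * ρ * Q + 67 * Q + 61 * Q ≡ 32 * (4 * suc ρ * Q)
      e₁ = solve-∀
      e₂ : ∀ ρ Q → 32 * (4 * ρ * Q + 2 * Q) + 3 * Q ≡ 128 * ρ * Q + 67 * Q + 0
      e₂ = solve-∀

    -- The type is a natural number tied to the index by an equation, so that the induction over
    -- types is plain induction.
    Tester : ℕ → Fin n → Set
    Tester t w = Σ (Fin s) λ i → role w ≡ inj₁ i × toℕ i ≡ t

    same-rank : ∀ z z′ i i′ → typical z ≡ true → typical z′ ≡ true → p z ≡ p z′ →
                role z ≡ inj₁ i → role z′ ≡ inj₁ i′ → rank (toℕ i) (pos z) ≡ rank (toℕ i′) (pos z′)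
    same-rank z z′ i i′ tz tz′ pz≡pz′ rz rz′ =
      ≤-antisym (rank-mono z z′ i i′ tz tz′ pz≡pz′ rz rz′) (rank-mono z′ z i′ i tz′ tz (sym pz≡pz′) rz′ rz)

    -- Type 0 occupies the ranks below `m 0`, while type `suc t` has the single rank `m 0 + t`.
    rank-injective : ∀ t t′ x x′ → rank t x ≡ rank t′ x′ → t ≡ t′
    rank-injective zero    zero     x x′ eq = refl
    rank-injective (suc t) (suc t′) x x′ eq = cong suc (+-cancelˡ-≡ (m 0) t t′ eq)
    rank-injective zero    (suc t′) x x′ eq = contradiction eq (<⇒≢ (<-≤-trans (toℕ<n (label 0 x)) (m≤m+n _ _)))
    rank-injective (suc t) zero     x x′ eq = contradiction (sym eq) (<⇒≢ (<-≤-trans (toℕ<n (label 0 x′)) (m≤m+n _ _)))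

    same-type : ∀ {t} z z′ i → typical z ≡ true → typical z′ ≡ true → p z ≡ p z′ →
                role z ≡ inj₁ i → Tester t z′ → toℕ i ≡ t
    same-type z z′ i tz tz′ pz≡pz′ rz (i′ , rz′ , refl) =
      rank-injective _ _ (pos z) (pos z′) (same-rank z z′ i i′ tz tz′ pz≡pz′ rz rz′)

    isType : ℕ → Role → Bool
    isType t (inj₁ i) = toℕ i ≡ᵇ t
    isType t (inj₂ f) = false

    isType-sound : ∀ t w → isType t (role w) ≡ true → Tester t w
    isType-sound t w eq with role w
    ... | inj₁ i = i , refl , ≡ᵇ-sound _ t eq

    sum-type : ∀ t → t ℕ.< s → (g : Fin Q → Bool) →
               sum (λ w → bit (isType t (role w) ∧ g (pos w))) ≡ sum (bit ∘ g)
    sum-type t t<s g = begin-equality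
      sum (λ w → bit (isType t (role w) ∧ g (pos w)))          ≡⟨ sum-vertices (λ b x → bit (isType t b ∧ g x)) ⟩
      sum {s} (λ i → sum λ x → bit ((toℕ i ≡ᵇ t) ∧ g x)) + sum {F} (λ f → sum {Q} λ _ → 0)
        ≡⟨ cong₂ _+_ (sum-cong inner) (trans (sum-cong λ f → trans (sum-const Q 0) (*-zeroʳ Q)) (trans (sum-const F 0) (*-zeroʳ F))) ⟩
      sum {s} (λ i → bit (does (i₀ Fin.≟ i)) * sum (bit ∘ g)) + 0 ≡⟨ +-identityʳ _ ⟩
      sum {s} (λ i → bit (does (i₀ Fin.≟ i)) * sum (bit ∘ g))  ≡⟨ sum-pick i₀ _ ⟩
      sum (bit ∘ g)                                              ∎
      where
      i₀ = fromℕ< t<s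
      decide : ∀ i → (toℕ i ≡ᵇ t) ≡ does (i₀ Fin.≟ i)
      decide i with i₀ Fin.≟ i
      ... | yes refl = subst (λ a → (a ≡ᵇ t) ≡ true) (sym (toℕ-fromℕ< t<s)) (≡ᵇ-refl t)
      ... | no  i₀≢i with toℕ i ≡ᵇ t in eq
      ...   | false = refl
      ...   | true  = contradiction (toℕ-injective (trans (toℕ-fromℕ< t<s) (sym (≡ᵇ-sound _ t eq)))) i₀≢i
      inner : ∀ i → sum (λ x → bit ((toℕ i ≡ᵇ t) ∧ g x)) ≡ bit (does (i₀ Fin.≟ i)) * sum (bit ∘ g)
      inner i = begin-equality
        sum (λ x → bit ((toℕ i ≡ᵇ t) ∧ g x))       ≡⟨ sum-cong (λ x → bit-∧ (toℕ i ≡ᵇ t) (g x)) ⟩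
        sum (λ x → bit (toℕ i ≡ᵇ t) * bit (g x))   ≡⟨ *-sum (bit (toℕ i ≡ᵇ t)) (bit ∘ g) ⟨
        bit (toℕ i ≡ᵇ t) * sum (bit ∘ g)           ≡⟨ cong (λ b → bit b * sum (bit ∘ g)) (decide i) ⟩
        bit (does (i₀ Fin.≟ i)) * sum (bit ∘ g)    ∎

    atypicals : Fin ℓ → ℕ
    atypicals j = sum λ w → member adj p j w * bit (not (typical w))

    -- The dichotomy behind both counts over parts: a part either offers a typical reference vertex
    -- in `S`, or its share of `S` is paid for by its atypical vertices.
    typical-witness : ∀ (S : Fin n → Bool) j →
      (Σ (Fin n) λ w → p w ≡ j × typical w ≡ true × S w ≡ true) ⊎
      sum (λ w → member adj p j w * bit (S w)) ≤ atypicals j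
    typical-witness S j with any? (λ w → (p w Fin.≟ j) ×-dec ((typical w ≟ᵇ true) ×-dec (S w ≟ᵇ true)))
    ... | yes (w , h) = inj₁ (w , h)
    ... | no  none    = inj₂ (sum-mono-≤ bound)
      where
      bound : ∀ w → member adj p j w * bit (S w) ≤ member adj p j w * bit (not (typical w))
      bound w with p w Fin.≟ j | typical w in tw | S w in Sw
      ... | no _     | _     | _     = z≤n
      ... | yes _    | _     | false = z≤n
      ... | yes _    | false | true  = ≤-refl
      ... | yes pw≡j | true  | true  = contradiction (w , pw≡j , tw , Sw) none

    link-next : ∀ t x y → link (suc t) t y x ≡ test t x y
    link-next t x y rewrite 2+a≢ᵇa t | ≡ᵇ-refl t = refl

    Separated : ℕ → Fin n → Fin n → Fin n → Bool
    Separated t z z′ w = isType t (role w) ∧ (test t (pos w) (pos z) xor test t (pos w) (pos z′))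

    SameLabels : ℕ → Set
    SameLabels t = ∀ z z′ → typical z ≡ true → typical z′ ≡ true → p z ≡ p z′ →
                   Tester t z → Tester t z′ → label t (pos z) ≡ label t (pos z′)

    module Step (t : ℕ) (IH : SameLabels t) where

      -- A typical vertex of part j on which z and z′ differ forces all typical testers of
      -- that part to have the same type and label, hence to distinguish z from z′ alike.
      one-sided : ∀ z z′ j w₀ → Tester (suc t) z → Tester (suc t) z′ → p w₀ ≡ j → typical w₀ ≡ true → Tester t w₀ →
        test t (pos w₀) (pos z) ≡ true → test t (pos w₀) (pos z′) ≡ false → (S : Fin n → Bool) →
        (∀ w → S w ≡ true → isType t (role w) ≡ true) →
        sum (λ w → member adj p j w * bit (S w)) + degInto adj p z′ j ≤ degInto adj p z j + 2 * atypicals j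
      one-sided z z′ j w₀ (i , rz , i≡) (i′ , rz′ , i′≡) pw₀ tw₀ type₀ ztrue z′false S S⊆ = begin
        sum (λ w → μ w * bit (S w)) + sum (λ w → μ w * bit (adj z′ w))      ≡⟨ sum-+ _ _ ⟨
        sum (λ w → μ w * bit (S w) + μ w * bit (adj z′ w))                  ≤⟨ sum-mono-≤ pointwise ⟩
        sum (λ w → μ w * bit (adj z w) + 2 * (μ w * bit (not (typical w)))) ≡⟨ sum-+ _ _ ⟩
        degInto adj p z j + sum (λ w → 2 * (μ w * bit (not (typical w))))   ≡⟨ cong (degInto adj p z j +_) (*-sum 2 _) ⟨
        degInto adj p z j + 2 * atypicals j                                 ∎
        where
        μ = member adj p j
        adj-z : ∀ w → adj z w ≡ joined (inj₁ i) (pos z) (role w) (pos w)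
        adj-z w = cong (λ r → joined r (pos z) (role w) (pos w)) rz
        adj-z′ : ∀ w → adj z′ w ≡ joined (inj₁ i′) (pos z′) (role w) (pos w)
        adj-z′ w = cong (λ r → joined r (pos z′) (role w) (pos w)) rz′
        tested : ∀ w y i k → typical w ≡ true → p w ≡ j → role w ≡ inj₁ k → toℕ i ≡ suc t →
                 joined (inj₁ i) y (inj₁ k) (pos w) ≡ test t (pos w₀) y
        tested w y i k tw pw rw i≡ with same-type w w₀ k tw tw₀ (trans pw (sym pw₀)) rw type₀
        ... | refl rewrite i≡ = trans (link-next t (pos w) y)
          (cong (lookup (Code.word (code t) (label (suc t) y))) (IH w w₀ tw tw₀ (trans pw (sym pw₀)) (k , rw , refl) type₀))
        core : ∀ w → p w ≡ j → bit (S w) + bit (adj z′ w) ≤ bit (adj z w) + 2 * bit (not (typical w))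
        core w pw with typical w in tw
        -- An atypical `w` may spoil both summands on the left, hence the factor 2.
        ... | false = ≤-trans (+-mono-≤ (bit≤1 (S w)) (bit≤1 (adj z′ w))) (m≤n+m 2 _)
        ... | true  = subst₂ (λ a b → bit (S w) + bit a ≤ bit b + 0) (sym (adj-z′ w)) (sym (adj-z w)) (by-role (role w) refl)
          where
          by-role : ∀ b → role w ≡ b →
            bit (S w) + bit (joined (inj₁ i′) (pos z′) b (pos w)) ≤ bit (joined (inj₁ i) (pos z) b (pos w)) + 0
          by-role (inj₁ k) rw = subst₂ (λ a b → bit (S w) + bit a ≤ bit b + 0)
            (sym (trans (tested w (pos z′) i′ k tw pw rw i′≡) z′false)) (sym (trans (tested w (pos z) i k tw pw rw i≡) ztrue))
            (≤-trans (≤-reflexive (+-identityʳ _)) (bit≤1 (S w)))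
          -- Both `z` and `z′` have rank `m 0 + t`, so a filler is adjacent to both or to neither.
          by-role (inj₂ f) rw with S w in Sw
          ... | false rewrite i≡ | i′≡ = ≤-reflexive (sym (+-identityʳ _))
          ... | true  with () ← trans (sym (cong (isType t) rw)) (S⊆ w Sw)
        pointwise : ∀ w → μ w * bit (S w) + μ w * bit (adj z′ w) ≤ μ w * bit (adj z w) + 2 * (μ w * bit (not (typical w)))
        pointwise w with p w Fin.≟ j
        ... | no  _  = z≤n
        ... | yes pw = subst₂ _≤_ (unit₁ (bit (S w)) (bit (adj z′ w))) (unit₂ (bit (adj z w)) (bit (not (typical w)))) (core w pw)
          where
          unit₁ : ∀ a b → a + b ≡ 1 * a + 1 * b
          unit₁ = solve-∀
          unit₂ : ∀ a b → a + 2 * b ≡ 1 * a + 2 * (1 * b)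
          unit₂ = solve-∀

      -- One typical separated vertex in part `j` fixes the direction in which `z` and `z′` differ
      -- on that part. The separated vertices then do not cancel in the degree difference.
      separation-in : ∀ z z′ j → Tester (suc t) z → Tester (suc t) z′ →
        sum (λ w → member adj p j w * bit (Separated t z z′ w)) ≤
        ∣ degInto adj p z j - degInto adj p z′ j ∣ + 2 * atypicals j
      separation-in z z′ j type type′ with typical-witness (Separated t z z′) j
      ... | inj₂ ≤atypicals = ≤-trans ≤atypicals (≤-trans (m≤m+n _ _) (m≤n+m _ ∣ degInto adj p z j - degInto adj p z′ j ∣))
      ... | inj₁ (w , pw , tw , Sw) = orient (test t (pos w) (pos z)) (test t (pos w) (pos z′)) refl refl (proj₂ (∧-split Sw))
        where
        ∧-split : ∀ {a b} → a ∧ b ≡ true → a ≡ true × b ≡ true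
        ∧-split {true} {true} _ = refl , refl
        S = Separated t z z′
        a = sum λ w → member adj p j w * bit (S w)
        S⊆ : ∀ w → S w ≡ true → isType t (role w) ≡ true
        S⊆ w = proj₁ ∘ ∧-split
        to-∣-∣ : ∀ b c e → a + b ≤ c + e → a ≤ ∣ c - b ∣ + e
        to-∣-∣ b c e le = +-cancelʳ-≤ b _ _ (begin
          a + b                    ≤⟨ le ⟩
          c + e                    ≤⟨ +-monoˡ-≤ e (m≤n+∣m-n∣ c b) ⟩
          b + ∣ c - b ∣ + e        ≡⟨ rotate b ∣ c - b ∣ e ⟩
          ∣ c - b ∣ + e + b        ∎)
          where
          rotate : ∀ x y z → x + y + z ≡ y + z + x
          rotate = solve-∀
        type₀ = isType-sound t w (S⊆ w Sw)
        orient : ∀ u v → test t (pos w) (pos z) ≡ u → test t (pos w) (pos z′) ≡ v → test t (pos w) (pos z) xor test t (pos w) (pos z′) ≡ true →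
                 a ≤ ∣ degInto adj p z j - degInto adj p z′ j ∣ + 2 * atypicals j
        -- Whichever of `z` and `z′` is adjacent to `w` takes the first role in `one-sided`.
        orient true  false eu ev _ = to-∣-∣ (degInto adj p z′ j) (degInto adj p z j) _ (one-sided z z′ j w type type′ pw tw type₀ eu ev S S⊆)
        orient false true  eu ev _ = subst (λ x → a ≤ x + 2 * atypicals j) (∣-∣-comm (degInto adj p z′ j) (degInto adj p z j))
                                       (to-∣-∣ (degInto adj p z j) (degInto adj p z′ j) _ (one-sided z′ z j w type′ type pw tw type₀ ev eu S S⊆))
        orient true  true  eu ev x rewrite eu | ev with () ← x
        orient false false eu ev x rewrite eu | ev with () ← x

      separation : ∀ z z′ → Tester (suc t) z → Tester (suc t) z′ →
        sum (bit ∘ Separated t z z′) ≤ deviation adj p z z′ + 2 * sum (λ w → bit (not (typical w)))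
      separation z z′ type type′ = begin
        sum (bit ∘ Separated t z z′)                                                      ≡⟨ sum-fibres p _ ⟩
        sum (λ j → sum λ w → member adj p j w * bit (Separated t z z′ w))                ≤⟨ sum-mono-≤ (λ j → separation-in z z′ j type type′) ⟩
        sum (λ j → ∣ degInto adj p z j - degInto adj p z′ j ∣ + 2 * atypicals j)         ≡⟨ sum-+ _ _ ⟩
        deviation adj p z z′ + sum (λ j → 2 * atypicals j)                                ≡⟨ cong (deviation adj p z z′ +_) (*-sum 2 atypicals) ⟨
        deviation adj p z z′ + 2 * sum atypicals                                          ≡⟨ cong (λ x → deviation adj p z z′ + 2 * x) (sum-fibres p (λ w → bit (not (typical w)))) ⟨
        deviation adj p z z′ + 2 * sum (λ w → bit (not (typical w)))                      ∎

      -- The two code words differ in at least a quarter of the `m t` positions, and each position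
      -- is the label of `Q / m t` testers of type `t`.
      many-separated : t ℕ.< s → ∀ z z′ → label (suc t) (pos z) ≢ label (suc t) (pos z′) →
                       Q ≤ 4 * sum (bit ∘ Separated t z z′)
      many-separated t<s z z′ ℓ≢ℓ′ = *-cancelˡ-≤ (m t) (begin
        m t * Q                                      ≤⟨ *-monoˡ-≤ Q (m≤4d t) ⟩
        4 * d t * Q                                  ≤⟨ *-monoˡ-≤ Q (*-monoʳ-≤ 4 (Code.distant (code t) b b′ ℓ≢ℓ′)) ⟩
        4 * distance v v′ * Q                        ≡⟨ rearrange₁ (distance v v′) Q ⟩
        4 * (Q * distance v v′)                      ≡⟨ cong (4 *_) (sum-mod (m t) (m∣Q t t<s) (λ a → bit (lookup v a xor lookup v′ a))) ⟨
        4 * (m t * sum (bit ∘ g))                    ≡⟨ rearrange₂ (m t) _ ⟩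
        m t * (4 * sum (bit ∘ g))                    ≡⟨ cong (λ x → m t * (4 * x)) (sum-type t t<s g) ⟨
        m t * (4 * sum (bit ∘ Separated t z z′))     ∎)
        where
        b = label (suc t) (pos z)
        b′ = label (suc t) (pos z′)
        v = Code.word (code t) b
        v′ = Code.word (code t) b′
        g : Fin Q → Bool
        g x = test t x (pos z) xor test t x (pos z′)
        rearrange₁ : ∀ D Q → 4 * D * Q ≡ 4 * (Q * D)
        rearrange₁ = solve-∀
        rearrange₂ : ∀ m x → 4 * (m * x) ≡ m * (4 * x)
        rearrange₂ = solve-∀

      same-labels-suc : SameLabels (suc t)
      same-labels-suc z z′ tz tz′ pz≡pz′ type@(i , _ , i≡) type′ with label (suc t) (pos z) Fin.≟ label (suc t) (pos z′)
      ... | yes eq = eq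
      ... | no  ℓ≢ℓ′ = contradiction 8Q≤5Q (<⇒≱ (*-monoˡ-< Q (≤ᵇ⇒≤ 6 8 _)))
        where
        t<s : t ℕ.< s
        t<s = <⇒≤ (subst (ℕ._< s) i≡ (toℕ<n i))
        A = sum λ w → bit (not (typical w))
        rearrange : ∀ δ A → 32 * (δ + 2 * A) ≡ 32 * δ + 2 * (32 * A)
        rearrange = solve-∀
        collect : ∀ Q → 3 * Q + 2 * Q ≡ 5 * Q
        collect = solve-∀
        8Q≤5Q : 8 * Q ≤ 5 * Q
        8Q≤5Q = begin
          8 * Q                                        ≤⟨ *-monoʳ-≤ 8 (many-separated t<s z z′ ℓ≢ℓ′) ⟩
          8 * (4 * sum (bit ∘ Separated t z z′))       ≡⟨ *-assoc 8 4 (sum (bit ∘ Separated t z z′)) ⟨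
          32 * sum (bit ∘ Separated t z z′)            ≤⟨ *-monoʳ-≤ 32 (separation z z′ type type′) ⟩
          32 * (deviation adj p z z′ + 2 * A)          ≡⟨ rearrange (deviation adj p z z′) A ⟩
          32 * deviation adj p z z′ + 2 * (32 * A)     ≤⟨ +-mono-≤ (deviation-small z z′ tz tz′ pz≡pz′) (*-monoʳ-≤ 2 atypical-few) ⟩
          3 * Q + 2 * Q                                ≡⟨ collect Q ⟩
          5 * Q                                        ∎

    same-labels : ∀ t → SameLabels t
    -- The rank of a type 0 tester is its label, so equal ranks start the induction.
    same-labels zero z z′ tz tz′ pz≡pz′ (i , rz , i≡0) (i′ , rz′ , i′≡0) =
      toℕ-injective (subst₂ (λ a b → rank a (pos z) ≡ rank b (pos z′)) i≡0 i′≡0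
        (same-rank z z′ i i′ tz tz′ pz≡pz′ rz rz′))
    same-labels (suc t) = Step.same-labels-suc t (same-labels t)

    -- Counting parts by the labels they capture

    module Count (t : ℕ) (t<s : t ℕ.< s) where

      class-size : ∀ a → m t * sum (λ x → bit (does (a Fin.≟ label t x))) ≡ Q
      class-size a = begin-equality
        m t * sum (λ x → bit (does (a Fin.≟ label t x)))  ≡⟨ sum-mod (m t) (m∣Q t t<s) (λ b → bit (does (a Fin.≟ b))) ⟩
        Q * sum (λ b → bit (does (a Fin.≟ b)))             ≡⟨ cong (Q *_) (sum-cong λ b → *-identityʳ _) ⟨
        Q * sum (λ b → bit (does (a Fin.≟ b)) * 1)         ≡⟨ cong (Q *_) (sum-pick a (λ _ → 1)) ⟩
        Q * 1                                               ≡⟨ *-identityʳ Q ⟩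
        Q                                                   ∎

      -- All typical testers of type `t` in part `j` have the label of one of them, and only
      -- `Q / m t` vertices of type `t` carry that label.
      type-in : ∀ j → m t * sum (λ w → member adj p j w * bit (isType t (role w))) ≤ m t * atypicals j + Q
      type-in j with typical-witness (isType t ∘ role) j
      ... | inj₂ ≤atypicals = ≤-trans (*-monoʳ-≤ (m t) ≤atypicals) (m≤m+n _ Q)
      ... | inj₁ (w₀ , pw₀ , tw₀ , S₀) = begin
        m t * sum (λ w → μ w * bit (isType t (role w)))    ≤⟨ *-monoʳ-≤ (m t) (sum-mono-≤ bound) ⟩
        m t * sum (λ w → μ w * bit (not (typical w)) + bit (isType t (role w) ∧ alike (pos w)))
                                                            ≡⟨ cong (m t *_) (sum-+ _ _) ⟩
        m t * (atypicals j + sum (λ w → bit (isType t (role w) ∧ alike (pos w))))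
                                                            ≡⟨ cong (λ x → m t * (atypicals j + x)) (sum-type t t<s alike) ⟩
        m t * (atypicals j + sum (bit ∘ alike))            ≡⟨ *-distribˡ-+ (m t) (atypicals j) _ ⟩
        m t * atypicals j + m t * sum (bit ∘ alike)        ≡⟨ cong (m t * atypicals j +_) (class-size a) ⟩
        m t * atypicals j + Q                               ∎
        where
        μ = member adj p j
        a = label t (pos w₀)
        alike : Fin Q → Bool
        alike x = does (a Fin.≟ label t x)
        bound : ∀ w → μ w * bit (isType t (role w)) ≤ μ w * bit (not (typical w)) + bit (isType t (role w) ∧ alike (pos w))
        bound w with p w Fin.≟ j | isType t (role w) in St | typical w in tw
        ... | no _   | _     | _     = z≤n
        ... | yes _  | false | _     = z≤n
        ... | yes _  | true  | false = s≤s z≤n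
        ... | yes pw | true  | true  with a Fin.≟ label t (pos w)
        ...   | yes _ = ≤-refl
        ...   | no a≢ = contradiction (same-labels t w₀ w tw₀ tw (trans pw₀ (sym pw)) (isType-sound t w₀ S₀) (isType-sound t w St)) a≢

      labels≤2ℓ : m t ≤ 2 * ℓ
      -- Atypical vertices cost at most a 32nd of the class, leaving `31 * m t ≤ 32 * ℓ`; rounding
      -- 32 up to 62 gives the factor 2.
      labels≤2ℓ = *-cancelˡ-≤ 31 (≤-trans (*-cancelʳ-≤ _ _ Q 31mQ≤32ℓQ) (≤-trans (*-monoˡ-≤ ℓ (≤ᵇ⇒≤ 32 62 _)) (≤-reflexive (*-assoc 31 2 ℓ))))
        where
        A = sum λ w → bit (not (typical w))
        Q≡ : sum (bit ∘ isType t ∘ role) ≡ Q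
        Q≡ = begin-equality
          sum (bit ∘ isType t ∘ role)                     ≡⟨ sum-cong (λ w → ∧-true (isType t (role w))) ⟩
          sum (λ w → bit (isType t (role w) ∧ true))     ≡⟨ sum-type t t<s (λ _ → true) ⟩
          sum {Q} (λ _ → 1)                               ≡⟨ trans (sum-const Q 1) (*-identityʳ Q) ⟩
          Q                                               ∎
          where
          ∧-true : ∀ b → bit b ≡ bit (b ∧ true)
          ∧-true true  = refl
          ∧-true false = refl
        mQ≤ : m t * Q ≤ m t * A + ℓ * Q
        mQ≤ = begin
          m t * Q                                                           ≡⟨ cong (m t *_) (trans (sym (sum-fibres p _)) Q≡) ⟨
          m t * sum (λ j → sum λ w → member adj p j w * bit (isType t (role w)))
                                                                            ≡⟨ *-sum (m t) _ ⟩
          sum (λ j → m t * sum λ w → member adj p j w * bit (isType t (role w)))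
                                                                            ≤⟨ sum-mono-≤ type-in ⟩
          sum (λ j → m t * atypicals j + Q)                                ≡⟨ sum-+ _ _ ⟩
          sum (λ j → m t * atypicals j) + sum {ℓ} (λ _ → Q)                ≡⟨ cong₂ _+_ (*-sum (m t) atypicals) (sym (sum-const ℓ Q)) ⟨
          m t * sum atypicals + ℓ * Q                                      ≡⟨ cong (λ x → m t * x + ℓ * Q) (sum-fibres p (λ w → bit (not (typical w)))) ⟨
          m t * A + ℓ * Q                                                   ∎
        31mQ≤32ℓQ : 31 * m t * Q ≤ 32 * ℓ * Q
        31mQ≤32ℓQ = +-cancelˡ-≤ (m t * Q) _ _ (begin
          m t * Q + 31 * m t * Q              ≡⟨ e₁ (m t) Q ⟩
          32 * (m t * Q)                      ≤⟨ *-monoʳ-≤ 32 mQ≤ ⟩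
          32 * (m t * A + ℓ * Q)              ≡⟨ e₂ (m t) A ℓ Q ⟩
          m t * (32 * A) + 32 * ℓ * Q         ≤⟨ +-monoˡ-≤ _ (*-monoʳ-≤ (m t) atypical-few) ⟩
          m t * Q + 32 * ℓ * Q                ∎)
          where
          e₁ : ∀ m Q → m * Q + 31 * m * Q ≡ 32 * (m * Q)
          e₁ = solve-∀
          e₂ : ∀ m A ℓ Q → 32 * (m * A + ℓ * Q) ≡ m * (32 * A) + 32 * ℓ * Q
          e₂ = solve-∀

  degular⇒labels≤2ℓ : ∀ {U M} → U ≡ s + F → M ≡ 3072 * (U * U) → ∀ {ε} → ε ℚ.* ℕtoℚ M ℚ.≤ 1ℚ →
    ∀ {ℓ} → ℓ ≤ n → HasDegularPartition G ε ℓ → ∀ t → t ℕ.< s → m t ≤ 2 * ℓ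
  degular⇒labels≤2ℓ {U} {M} U≡ M≡ {ε} εM≤1 ℓ≤n (p , degular) t t<s =
    Rigidity.Count.labels≤2ℓ p typical atypical-few typical⇒deviation-small t t<s
    where
    U≢0 : NonZero U
    U≢0 = subst NonZero (sym U≡) (>-nonZero (≤-trans (≤-trans (s≤s z≤n) t<s) (m≤m+n s F)))
    open Profile adj p (Transfer.degular⇒Regular ε M εM≤1 G p degular) ℓ≤n
    open Typical Q U {{Q≢0}} {{U≢0}} (cong (_* Q) (sym U≡)) M≡

-- The tower

-- Code words have length `8 * r` with `r = octets t`. The summand 5 yields a factor `2 ^ 5`, which
-- absorbs the 8 and the 5 of the next level. For type 0 there are 48 labels, the number in `units`.
octets labels : ℕ → ℕ
octets t = towℕ t + 5
labels t = 8 * octets t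

labels≢0 : ∀ {t} → NonZero (labels t)
labels≢0 {t} = m*n≢0 8 (octets t) {{_}} {{≢-nonZero (m<n⇒n≢0 (m≤n+m 5 (towℕ t)))}}

1≤tow : ∀ t → 1 ≤ towℕ t
1≤tow zero    = ≤-refl
1≤tow (suc t) = m^n>0 2 (towℕ t)

labels-fit : ∀ t → labels (suc t) ≤ 2 ^ octets t
labels-fit t = begin
  8 * (W + 5)             ≡⟨ *-distribˡ-+ 8 W 5 ⟩
  -- `W` is at least 2, so `40 ≤ 24 * 2 ≤ 24 * W`.
  8 * W + 40              ≤⟨ +-monoʳ-≤ (8 * W) (≤-trans (≤ᵇ⇒≤ 40 48 _) (*-monoʳ-≤ 24 (^-monoʳ-≤ 2 (1≤tow t)))) ⟩
  8 * W + 24 * W          ≡⟨ collect W ⟩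
  W * 32                  ≡⟨ ^-distribˡ-+-* 2 (towℕ t) 5 ⟨
  2 ^ (towℕ t + 5)        ∎
  where
  W = 2 ^ towℕ t
  collect : ∀ W → 8 * W + 24 * W ≡ W * 32
  collect = solve-∀

codes : ∀ t → Code (labels t) (labels (suc t)) (2 * octets t)
codes t = code (octets t) (labels-fit t)

-- Serves as a common multiple of the label counts of all types below `s`.
∏labels : ℕ → ℕ
∏labels zero    = 1
∏labels (suc s) = labels s * ∏labels s

∏labels≢0 : ∀ s → NonZero (∏labels s)
∏labels≢0 zero    = _
∏labels≢0 (suc s) = m*n≢0 (labels s) (∏labels s) {{labels≢0 {s}}} {{∏labels≢0 s}}

labels∣∏labels : ∀ s t → t ℕ.< s → labels t ∣ ∏labels s
labels∣∏labels (suc s) t t<1+s with m<1+n⇒m<n∨m≡n t<1+s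
... | inj₁ t<s  = ∣-trans (labels∣∏labels s t t<s) (n∣m*n (labels s))
... | inj₂ refl = m∣m*n (∏labels s)

-- Choice of parameters and the final bound

module LowerBound (k D : ℕ) {{D≢0 : NonZero D}} where

  Q : ℕ
  Q = ∏labels (suc k) * D

  Q≢0 : NonZero Q
  Q≢0 = m*n≢0 (∏labels (suc k)) D {{∏labels≢0 (suc k)}}

  labels∣Q : ∀ t → t ℕ.< suc k → labels t ∣ Q
  labels∣Q t t<s = ∣-trans (labels∣∏labels (suc k) t t<s) (m∣m*n D)

  open Construction (suc k) Q labels (λ t → 2 * octets t) {{λ {t} → labels≢0 {t}}} {{Q≢0}} codes (λ t → ≤-reflexive (*-assoc 4 2 (octets t))) labels∣Q public

  Q≤n : Q ≤ n
  Q≤n = m≤n*m Q (units k)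

  tow≤labels : towℕ k ≤ labels k
  tow≤labels = ≤-trans (m≤m+n (towℕ k) 5) (m≤n*m (octets k) 8)

  -- The counting argument covers `ℓ ≤ n`. For larger `ℓ` the graph itself is big enough:
  -- `towℕ k ≤ labels k ≤ Q ≤ n`.
  tow≤complexity : ∀ {M} → M ≡ 3072 * (units k * units k) → ∀ {ε} → ε ℚ.* ℕtoℚ M ℚ.≤ 1ℚ →
                   ∀ ℓ → HasDegularPartition G ε ℓ → towℕ k ≤ ℓ
  tow≤complexity M≡ {ε} small ℓ partition = [ few-parts , many-parts ]′ (≤-total ℓ n)
    where
    few-parts : ℓ ≤ n → towℕ k ≤ ℓ
    -- The factor 8 in `labels k` outweighs the 2 in `labels k ≤ 2 * ℓ`.
    few-parts ℓ≤n = *-cancelˡ-≤ 2 (≤-trans (*-mono-≤ (≤ᵇ⇒≤ 2 8 _) (m≤m+n (towℕ k) 5))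
                      (degular⇒labels≤2ℓ {units k} refl M≡ {ε} small ℓ≤n partition k ≤-refl))
    many-parts : n ≤ ℓ → towℕ k ≤ ℓ
    many-parts = ≤-trans (≤-trans tow≤labels (≤-trans (∣⇒≤ {{Q≢0}} (labels∣Q k ≤-refl)) Q≤n))

theorem1p2 : Σ ℚ λ c → Σ ℚ λ ε₀ → (0ℚ < c) × (0ℚ < ε₀) ×
    (∀ ε → 0ℚ < ε → ε < ε₀ → D≥towCε⁻¹ᐟ³ c ε)
theorem1p2 = c₀ , c₀ ℚ.* c₀ ℚ.* c₀ , ℚ.positive⁻¹ c₀ , ℚ.positive⁻¹ (c₀ ℚ.* c₀ ℚ.* c₀) , bound
  where
  bound : ∀ ε → 0ℚ ℚ.< ε → ε ℚ.< c₀ ℚ.* c₀ ℚ.* c₀ → D≥towCε⁻¹ᐟ³ c₀ ε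
  bound ε 0<ε ε<c₀³ k k³ε≤c₀³ =
    -- The denominator of `ε` is a factor of `Q`, so `n` is large enough for the singletons to form
    -- a degular partition.
    G , (_ , Singletons.hasDegularPartition G ε 0<ε (1≤ε*n ε _ (ℚ.positive 0<ε) D≤n)) ,
    tow≤complexity refl {ε} (ε*M≤1 k ε 0<ε ε<c₀³ k³ε≤c₀³)
    where
    open LowerBound k (ℚ.↧ₙ ε)
    D≤n : ℚ.↧ₙ ε ≤ n
    D≤n = ≤-trans (m≤n*m (ℚ.↧ₙ ε) (∏labels (suc k)) {{∏labels≢0 (suc k)}}) Q≤n
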